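{- Let $p$ be a prime and $f:\mathbb{F}_{p^n}\to\mathbb{F}_p$ a cubic function (algebraic degree $3$). Then $f$ is bent if and only if $f$ is cubic-like bent, i.e. for every $a\in\mathbb{F}_{p^n}^*$ there exists $b\in\mathbb{F}_{p^n}$ such that $D_{a,b}f(x)=f(x+a+b)-f(x+a)-f(x+b)+f(x)$ is a nonzero constant function.
   Context: Let $\omega=e^{2\pi i/p}$ and $\mathrm{Tr}_n$ the absolute trace of $\mathbb{F}_{p^n}$. The Walsh transform of $g:\mathbb{F}_{p^n}\to\mathbb{F}_p$ is $W_g(y)=\sum_{x\in\mathbb{F}_{p^n}}\omega^{g(x)-\mathrm{Tr}_n(xy)}$. $f$ is bent if $|W_f(y)|^2=p^n$ for all $y$. The algebraic degree is the degree of the algebraic normal form (polynomial in coordinates over $\mathbb{F}_p$ with exponents less than $p$). -}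

module Defs where

open import Data.Nat using (ℕ; zero; suc; _+_; _*_; _∸_; _^_; _≤_; NonZero)
open import Data.Nat.DivMod using (_mod_)
open import Data.Fin using (Fin; toℕ) renaming (_≟_ to _≟ᶠ_)
open import Data.Integer as ℤ using (ℤ)
open import Data.List as L using (List; []; _∷_; allFin; filter; length; concatMap; foldr)
open import Data.List.Relation.Unary.All using (All)
open import Data.Vec as V using (Vec; []; _∷_; zipWith; replicate; init; last)
open import Data.Product using (Σ; ∃; _×_; _,_)
open import Relation.Binary.PropositionalEquality using (_≡_; _≢_)
open import Relation.Nullary using (¬_; does)
open import Data.Bool using (if_then_else_)
import Data.Nat as N

module _ (p : ℕ) {{_ : NonZero p}} where

  Fp : Set
  Fp = Fin p

  0ₚ 1ₚ : Fp
  0ₚ = 0 mod p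
  1ₚ = 1 mod p

  _+ₚ_ _*ₚ_ _-ₚ_ : Fp → Fp → Fp
  a +ₚ b = (toℕ a + toℕ b) mod p
  a *ₚ b = (toℕ a * toℕ b) mod p
  a -ₚ b = (toℕ a + (p ∸ toℕ b)) mod p

  negₚ : Fp → Fp
  negₚ a = (p ∸ toℕ a) mod p

  _^ₚ_ : Fp → ℕ → Fp
  a ^ₚ zero = 1ₚ
  a ^ₚ suc k = a *ₚ (a ^ₚ k)

  -- vectors over F_p : coordinates w.r.t. the basis 1, X, ..., X^(n-1)
  V : ℕ → Set
  V n = Vec Fp n

  allV : (n : ℕ) → List (V n)
  allV zero = [] ∷ []
  allV (suc n) = concatMap (λ a → L.map (a ∷_) (allV n)) (allFin p)

  zeroV : {n : ℕ} → V n
  zeroV = replicate _ 0ₚ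

  oneV : {n : ℕ} → V n
  oneV {zero} = []
  oneV {suc n} = 1ₚ ∷ zeroV

  _⊕_ : {n : ℕ} → V n → V n → V n
  _⊕_ = zipWith _+ₚ_

  _⊖_ : {n : ℕ} → V n → V n → V n
  _⊖_ = zipWith _-ₚ_

  -- F_p[X]/(g) where g = X^n + g_(n-1) X^(n-1) + ... + g_0 is given by
  -- its lower coefficient vector (g_0, ..., g_(n-1)).

  mulX : {n : ℕ} → V n → V n → V n
  mulX {zero} g v = []
  mulX {suc n} g v = zipWith _-ₚ_ (0ₚ ∷ init v) (V.map (last v *ₚ_) g)

  mul' : {n k : ℕ} → V n → Vec Fp k → V n → V n
  mul' g [] b = zeroV
  mul' g (a ∷ as) b = V.map (a *ₚ_) b ⊕ mulX g (mul' g as b)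

  fmul : {n : ℕ} → V n → V n → V n → V n
  fmul g a b = mul' g a b

  fpow : {n : ℕ} → V n → V n → ℕ → V n
  fpow g z zero = oneV
  fpow g z (suc k) = fmul g z (fpow g z k)

  IsField : {n : ℕ} → V n → Set
  IsField g = ∀ a → a ≢ zeroV → ∃ λ b → fmul g a b ≡ oneV

  coeff0 : {n : ℕ} → V n → Fp
  coeff0 [] = 0ₚ
  coeff0 (a ∷ _) = a

  -- absolute trace Tr_n(z) = z + z^p + ... + z^(p^(n-1)); it lies in the
  -- prime field F_p = constant polynomials, so we read off coefficient 0
  Tr : {n : ℕ} → V n → V n → Fp
  Tr {n} g z = coeff0 (foldr _⊕_ zeroV (L.map (λ i → fpow g z (p ^ toℕ i)) (allFin n)))

  -- Z[ω], ω = e^(2πi/p): the group ring Z[C_p] (Fin p → ℤ, u ↦ Σ u_k ω^k)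
  -- modulo the ideal generated by 1 + ω + ... + ω^(p-1) (p prime).
  Zω : Set
  Zω = Fp → ℤ

  sumℤ : List ℤ → ℤ
  sumℤ = foldr ℤ._+_ (ℤ.+ 0)

  _·ω_ : Zω → Zω → Zω
  (u ·ω v) k = sumℤ (L.map (λ j → u j ℤ.* v (k -ₚ j)) (allFin p))

  conjω : Zω → Zω
  conjω u k = u (negₚ k)

  -- equality in Z[ω]: the difference is a multiple of 1 + ω + ... + ω^(p-1)
  _≈ω_ : Zω → Zω → Set
  u ≈ω v = ∃ λ (c : ℤ) → ∀ k → u k ℤ.- v k ≡ c

  intω : ℕ → Zω
  intω m k = if does (k ≟ᶠ 0ₚ) then ℤ.+ m else ℤ.+ 0

  -- Walsh transform W_g(y) = Σ_x ω^(f(x) - Tr(xy)) as an element of Z[ω]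
  Walsh : {n : ℕ} → V n → (V n → Fp) → V n → Zω
  Walsh {n} g f y k =
    ℤ.+ length (filter (λ x → (f x -ₚ Tr g (fmul g x y)) ≟ᶠ k) (allV n))

  Bent : {n : ℕ} → V n → (V n → Fp) → Set
  Bent {n} g f = ∀ y → (Walsh g f y ·ω conjω (Walsh g f y)) ≈ω intω (p ^ n)

  -- algebraic degree via the algebraic normal form in the coordinates:
  -- a reduced polynomial is a list of terms c · x_1^(e_1) ... x_n^(e_n), 0 ≤ e_i < p
  Term : ℕ → Set
  Term n = Fp × Vec (Fin p) n

  monoDeg : {n : ℕ} → Vec (Fin p) n → ℕ
  monoDeg e = V.foldr _ (λ a r → toℕ a + r) 0 e

  evalMono : {n : ℕ} → Vec (Fin p) n → V n → Fp
  evalMono [] [] = 1ₚ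
  evalMono (e ∷ es) (x ∷ xs) = (x ^ₚ toℕ e) *ₚ evalMono es xs

  evalPoly : {n : ℕ} → List (Term n) → V n → Fp
  evalPoly [] x = 0ₚ
  evalPoly ((c , e) ∷ ts) x = (c *ₚ evalMono e x) +ₚ evalPoly ts x

  DegLe : {n : ℕ} → (V n → Fp) → ℕ → Set
  DegLe {n} f d = ∃ λ (P : List (Term n)) →
    All (λ t → monoDeg (Data.Product.proj₂ t) ≤ d) P × (∀ x → evalPoly P x ≡ f x)

  Cubic : {n : ℕ} → (V n → Fp) → Set
  Cubic f = DegLe f 3 × ¬ DegLe f 2

  D2 : {n : ℕ} → (V n → Fp) → V n → V n → V n → Fp
  D2 f a b x = (((f ((x ⊕ a) ⊕ b) -ₚ f (x ⊕ a)) -ₚ f (x ⊕ b)) +ₚ f x)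

  CubicLikeBent : {n : ℕ} → (V n → Fp) → Set
  CubicLikeBent f = ∀ a → a ≢ zeroV →
    ∃ λ b → ∃ λ c → c ≢ 0ₚ × (∀ x → D2 f a b x ≡ c)

{-# OPTIONS --safe #-}
module Submission where

open import Defs
open import Data.Nat using (ℕ; NonZero; _≤_)
open import Data.Nat.Primality using (Prime)
open import Data.Vec using (Vec)
open import Data.Fin using (Fin)
open import Function.Bundles using (_⇔_)

open import Algebra using (Op₁; Op₂; CommutativeRing)
open import Algebra.Structures using (IsAbelianGroup; IsCommutativeMonoid; IsCommutativeRing)
import Algebra.Definitions.RawMonoid
import Algebra.Properties.CommutativeSemiring.Binomial
import Algebra.Properties.Group
import Algebra.Properties.Monoid.Sum
import Algebra.Properties.Ring
import Algebra.Properties.Semiring.Exp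
import Algebra.Properties.Semiring.Mult
import Algebra.Solver.Ring
import Algebra.Solver.Ring.AlmostCommutativeRing as ACR
open import Data.Bool using (if_then_else_)
open import Data.Fin using (toℕ; zero; suc; inject₁; fromℕ)
import Data.Fin.Properties as Finₚ
open import Data.Integer as ℤ using (ℤ; -[1+_]) renaming (+_ to pos)
import Data.Integer.Properties as ℤₚ
import Data.Integer.Tactic.RingSolver as ℤ-Solver
open import Data.List as L using (List; []; _∷_; foldr; filter; length; allFin; cartesianProductWith)
open import Data.List.Membership.Propositional using (_∈_; lose)
open import Data.List.Membership.Propositional.Properties
  using (∈-allFin; ∈-map⁺; ∈-map⁻; ∈-filter⁺; ∈-filter⁻; ∈-cartesianProductWith⁺)
open import Data.List.Membership.Propositional.Properties.WithK using (unique∧set⇒bag)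
import Data.List.Properties as Lₚ
open import Data.List.Relation.Binary.BagAndSetEquality using (∼bag⇒↭)
open import Data.List.Relation.Binary.Permutation.Propositional using (_↭_; ↭⇒↭ₛ)
import Data.List.Relation.Binary.Permutation.Propositional.Properties as ↭ₚ
import Data.List.Relation.Binary.Permutation.Setoid.Properties as ↭ₛₚ
open import Data.List.Relation.Unary.All as All using (All; []; _∷_)
import Data.List.Relation.Unary.All.Properties as Allₚ
open import Data.List.Relation.Unary.AllPairs using ([]; _∷_)
open import Data.List.Relation.Unary.Any as Any using (here; there)
open import Data.List.Relation.Unary.Unique.Propositional using (Unique)
import Data.List.Relation.Unary.Unique.Propositional.Properties as Uniqueₚ
open import Data.Maybe using (Maybe; just; nothing)
open import Data.Nat as ℕ using (zero; suc; z≤n; s≤s; z<s; s<s)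
open import Data.Nat.Combinatorics using (_C_; nC1≡n; nCn≡1; k>n⇒nCk≡0; nCk+nC[k+1]≡[n+1]C[k+1])
open import Data.Nat.Coprimality using (prime⇒coprime; coprime-Bézout)
open import Data.Nat.Divisibility using (_∣_; divides; >⇒∤; m∣m*n)
open import Data.Nat.DivMod
  using (_mod_; _%_; %-distribˡ-+; %-distribˡ-*; m<n⇒m%n≡m; n%n≡0; m%n<n; [m+kn]%n≡m%n; m*n%n≡0)
import Data.Nat.GCD as GCD
open import Data.Nat.Primality using (euclidsLemma; prime⇒nonTrivial; prime⇒nonZero)
import Data.Nat.Properties as ℕₚ
import Data.Nat.Tactic.RingSolver as ℕ-Solver
open import Data.Product using (∃; _×_; _,_; proj₂; map₂)
open import Data.Sum using (inj₁; inj₂)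
open import Data.Vec as V using ([]; _∷_; zipWith; init; last)
import Data.Vec.Properties as Vₚ
open import Function.Base using (_∘_; id)
open import Function.Bundles using (mk⇔)
open import Level using (0ℓ)
open import Relation.Binary.Definitions using (DecidableEquality)
open import Relation.Binary.PropositionalEquality
open import Relation.Binary.PropositionalEquality.Algebra using (isMagma)
open import Relation.Nullary using (Dec; yes; no; does; ¬?; contradiction; _×-dec_)
open import Relation.Unary using (Pred; Decidable)

-- Write S(h) = Σ_x ω^(h x) and D_a h (x) = h (x + a) − h (x).  Then |S(h)|² = Σ_a S(D_a h),
-- and S(h) = 0 as soon as some translation of the argument adds a nonzero constant to h.
-- With h = f − Tr(· y), cubic-like bentness kills every term with a ≠ 0 and leaves
-- |W_f(y)|² = p^n.  Conversely, Fourier inversion over y turns bentness into S(D_a f) = 0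
-- for all a ≠ 0.  For cubic f the function q = D_a f is quadratic, so each D_b q is affine:
-- if none of them were a nonzero constant, each S(D_b q) would be 0 or p^n, and p^n for b = 0,
-- contradicting Σ_b S(D_b q) = |S(q)|² = 0.
-- Inversion needs the trace form to be nondegenerate: the trace is a polynomial of degree
-- p^(n-1), so it has a nonzero value, and its values are fixed by Frobenius, hence constants.
-- Vanishing in Z[ω] means that the p coefficients in the group ring agree (IsConstant).

-- The analysis takes place in the integral group ring of the additive group of F_p. There S(h) is
-- the vector `N h` of fibre sizes of h, and two vectors agree in Z[ω] exactly when their difference
-- is constant. One mechanism makes sums vanish: if a translation adds a nonzero d to h, then S(h) =
-- ω^d S(h), so the coefficients are invariant under the shift by d, which generates F_p
-- (`balanced`). One identity drives both directions: |S(h)|² is the sum of S(D_a h) over all a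
-- (`norm-N`).
--
-- From cubic-like to bent, apply the identity to x ↦ f x - Tr(xy). The subtracted function is
-- additive, so D_a f changes only by a constant and each a ≠ 0 contributes zero.
--
-- From bent to cubic-like, fix a ≠ 0. The sum of |W_f(y)|² ω^(Tr(ay)) over y is p^n times a
-- vanishing character sum, and by orthogonality it is also p^n S(D_a f); hence D_a f is balanced.
-- Now q = D_a f is quadratic, so each D_b q is affine, and S(D_b q) vanishes unless D_b q is
-- constant. These sums add up to |S(q)|² = 0 while b = 0 contributes p^n, so some D_b q is a
-- nonzero constant (`balanced-quadratic`).
--
-- Two algebraic inputs remain. Degree bounds are turned into vanishing iterated differences
-- (`DegLe⇒degreeBelow`), and orthogonality needs `pairing-nondegenerate`, which comes from counting
-- roots of the trace polynomial and of X^p - X.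

module RingSolver
  {A : Set} {_+_ _*_ : Op₂ A} { -_ : Op₁ A} {0# 1# : A}
  (isCR : IsCommutativeRing _≡_ _+_ _*_ -_ 0# 1#) where

  ring : CommutativeRing 0ℓ 0ℓ
  ring = record { isCommutativeRing = isCR }

  private
    module R = CommutativeRing ring
    open Algebra.Properties.Ring R.ring using (-0#≈0#; -‿involutive; -‿distribˡ-*; -‿distribʳ-*; -‿+-comm)
    open Algebra.Properties.Semiring.Mult R.semiring using (×-homo-+; ×1-homo-*) renaming (_×_ to _∙_)
    open ≡-Reasoning

    -- The canonical ring map. Integer coefficients have computable arithmetic and decidable
    -- equality, which an arbitrary `A` does not provide.
    ι : ℤ → A
    ι (pos n)  = n ∙ 1#
    ι -[1+ n ] = - (suc n ∙ 1#)

    ι-neg : ∀ i → ι (ℤ.- i) ≡ - ι i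
    ι-neg (pos zero)    = sym -0#≈0#
    ι-neg (pos (suc n)) = refl
    ι-neg -[1+ n ]      = sym (-‿involutive _)

    cancel-one : ∀ a b → (1# + a) + (- (1# + b)) ≡ a + (- b)
    cancel-one a b = begin
      (1# + a) + (- (1# + b))       ≡⟨ cong₂ _+_ (R.+-comm 1# a) (sym (-‿+-comm 1# b)) ⟩
      (a + 1#) + ((- 1#) + (- b))   ≡⟨ R.+-assoc a 1# _ ⟩
      a + (1# + ((- 1#) + (- b)))   ≡⟨ cong (a +_) (R.+-assoc 1# (- 1#) (- b)) ⟨
      a + ((1# + (- 1#)) + (- b))   ≡⟨ cong (λ z → a + (z + (- b))) (R.-‿inverseʳ 1#) ⟩
      a + (0# + (- b))              ≡⟨ cong (a +_) (R.+-identityˡ (- b)) ⟩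
      a + (- b)                     ∎

    ι-⊖ : ∀ m n → ι (m ℤ.⊖ n) ≡ (m ∙ 1#) + (- (n ∙ 1#))
    ι-⊖ zero    zero    = sym (R.-‿inverseʳ 0#)
    ι-⊖ zero    (suc n) = sym (R.+-identityˡ _)
    ι-⊖ (suc m) zero    = sym (trans (cong ((suc m ∙ 1#) +_) -0#≈0#) (R.+-identityʳ _))
    ι-⊖ (suc m) (suc n) = begin
      ι (suc m ℤ.⊖ suc n)                   ≡⟨ cong ι (ℤₚ.[1+m]⊖[1+n]≡m⊖n m n) ⟩
      ι (m ℤ.⊖ n)                           ≡⟨ ι-⊖ m n ⟩
      (m ∙ 1#) + (- (n ∙ 1#))             ≡⟨ cancel-one (m ∙ 1#) (n ∙ 1#) ⟨
      (suc m ∙ 1#) + (- (suc n ∙ 1#))     ∎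

    ι-+ : ∀ i j → ι (i ℤ.+ j) ≡ ι i + ι j
    ι-+ (pos m)  (pos n)  = ×-homo-+ 1# m n
    ι-+ (pos m)  -[1+ n ] = ι-⊖ m (suc n)
    ι-+ -[1+ m ] (pos n)  = trans (ι-⊖ n (suc m)) (R.+-comm _ _)
    ι-+ -[1+ m ] -[1+ n ] = begin
      - (suc (suc (m ℕ.+ n)) ∙ 1#)              ≡⟨ cong (λ k → - (suc k ∙ 1#)) (ℕₚ.+-suc m n) ⟨
      - ((suc m ℕ.+ suc n) ∙ 1#)                ≡⟨ cong -_ (×-homo-+ 1# (suc m) (suc n)) ⟩
      - ((suc m ∙ 1#) + (suc n ∙ 1#))           ≡⟨ -‿+-comm _ _ ⟨
      (- (suc m ∙ 1#)) + (- (suc n ∙ 1#))       ∎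

    ι-*⁺ : ∀ m j → ι (pos m ℤ.* j) ≡ (m ∙ 1#) * ι j
    ι-*⁺ m (pos n)  = trans (cong ι (sym (ℤₚ.pos-* m n))) (×1-homo-* m n)
    ι-*⁺ m -[1+ n ] = begin
      ι (pos m ℤ.* -[1+ n ])            ≡⟨ cong ι (ℤₚ.neg-distribʳ-* (pos m) (pos (suc n))) ⟨
      ι (ℤ.- (pos m ℤ.* pos (suc n)))       ≡⟨ ι-neg (pos m ℤ.* pos (suc n)) ⟩
      - ι (pos m ℤ.* pos (suc n))           ≡⟨ cong -_ (ι-*⁺ m (pos (suc n))) ⟩
      - ((m ∙ 1#) * (suc n ∙ 1#))     ≡⟨ -‿distribʳ-* _ _ ⟩
      (m ∙ 1#) * (- (suc n ∙ 1#))     ∎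

    ι-* : ∀ i j → ι (i ℤ.* j) ≡ ι i * ι j
    ι-* (pos m)  j = ι-*⁺ m j
    ι-* -[1+ m ] j = begin
      ι (-[1+ m ] ℤ.* j)              ≡⟨ cong ι (ℤₚ.neg-distribˡ-* (pos (suc m)) j) ⟨
      ι (ℤ.- (pos (suc m) ℤ.* j))         ≡⟨ ι-neg (pos (suc m) ℤ.* j) ⟩
      - ι (pos (suc m) ℤ.* j)             ≡⟨ cong -_ (ι-*⁺ (suc m) j) ⟩
      - ((suc m ∙ 1#) * ι j)          ≡⟨ -‿distribˡ-* _ _ ⟩
      (- (suc m ∙ 1#)) * ι j          ∎

    morphism : ℤ.+-*-rawRing ACR.-Raw-AlmostCommutative⟶ ACR.fromCommutativeRing ring
    morphism = record
      { ⟦_⟧    = ι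
      ; +-homo = ι-+
      ; *-homo = ι-*
      ; -‿homo = ι-neg
      ; 0-homo = refl
      ; 1-homo = R.+-identityʳ 1#
      }

    -- Only a sufficient test: in positive characteristic distinct integers can have equal images,
    -- and answering `nothing` is still sound.
    coefficient≟ : ∀ i j → Maybe (ι i ≡ ι j)
    coefficient≟ i j with i ℤ.≟ j
    ... | yes i≡j = just (cong ι i≡j)
    ... | no  _   = nothing

  open Algebra.Solver.Ring ℤ.+-*-rawRing (ACR.fromCommutativeRing ring) morphism coefficient≟ public
    using (solve; _:=_; _:+_; _:*_; _:-_; :-_; con)

-- _∸_ stands for the subtraction _-ₚ_ of F_p, a primitive operation; it is not truncated.
module RingIdentities
  {A : Set} {_+_ _*_ : Op₂ A} { -_ : Op₁ A} {0# 1# : A}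
  (isCR : IsCommutativeRing _≡_ _+_ _*_ -_ 0# 1#)
  {_∸_ : Op₂ A} (∸-def : ∀ a b → a ∸ b ≡ a + (- b)) where

  open RingSolver isCR

  interchange : ∀ a b c d → (a + b) + (c + d) ≡ (a + c) + (b + d)
  interchange = solve 4 (λ a b c d → (a :+ b) :+ (c :+ d) := (a :+ c) :+ (b :+ d)) refl

  ∸-mul-+ : ∀ a b c l k → (a + b) ∸ ((l + k) * c) ≡ (a ∸ (l * c)) + (b ∸ (k * c))
  ∸-mul-+ a b c l k rewrite ∸-def (a + b) ((l + k) * c) | ∸-def a (l * c) | ∸-def b (k * c) =
    solve 5 (λ a b c l k → (a :+ b) :- ((l :+ k) :* c) := (a :- l :* c) :+ (b :- k :* c)) refl a b c l k

  ∸-mul-* : ∀ a b c l → (c * a) ∸ ((c * l) * b) ≡ c * (a ∸ (l * b))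
  ∸-mul-* a b c l rewrite ∸-def (c * a) ((c * l) * b) | ∸-def a (l * b) =
    solve 4 (λ a b c l → c :* a :- (c :* l) :* b := c :* (a :- l :* b)) refl a b c l

  ∸-mul-0 : ∀ a b → a ∸ (0# * b) ≡ a
  ∸-mul-0 a b rewrite ∸-def a (0# * b) = solve 2 (λ a b → a :- con ℤ.0ℤ :* b := a) refl a b

-- Enumerations, finite sums and indicator functions.

record Enumeration (A : Set) : Set where
  field
    elements : List A
    unique   : Unique elements
    complete : ∀ x → x ∈ elements

foldr-↭ : {A : Set} {_∙_ : Op₂ A} {ε : A} → IsCommutativeMonoid _≡_ _∙_ ε →
          {xs ys : List A} → xs ↭ ys → foldr _∙_ ε xs ≡ foldr _∙_ ε ys
foldr-↭ {A} isCM xs↭ys = ↭ₛₚ.foldr-commMonoid (setoid A) isCM (↭⇒↭ₛ xs↭ys)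

-- In a list without duplicates each membership has a single proof, so equality as sets is already
-- equality as bags.
sameElements⇒↭ : {A : Set} {xs ys : List A} → Unique xs → Unique ys →
                 (∀ {x} → x ∈ xs ⇔ x ∈ ys) → xs ↭ ys
sameElements⇒↭ uxs uys same = ∼bag⇒↭ (unique∧set⇒bag uxs uys same)

map-bijection-↭ : {A : Set} (E : Enumeration A) (f f⁻¹ : A → A) →
                  (∀ x → f (f⁻¹ x) ≡ x) → (∀ x → f⁻¹ (f x) ≡ x) →
                  L.map f (Enumeration.elements E) ↭ Enumeration.elements E
map-bijection-↭ E f f⁻¹ ff⁻¹ f⁻¹f = sameElements⇒↭ (Uniqueₚ.map⁺ injective unique) unique
  (mk⇔ (λ _ → complete _) (λ _ → subst (_∈ L.map f elements) (ff⁻¹ _) (∈-map⁺ f (complete (f⁻¹ _)))))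
  where
  open Enumeration E
  injective : ∀ {x y} → f x ≡ f y → x ≡ y
  injective fx≡fy = trans (sym (f⁻¹f _)) (trans (cong f⁻¹ fx≡fy) (f⁻¹f _))

module _ {A : Set} where

  ∑ : List A → (A → ℤ) → ℤ
  ∑ xs F = foldr ℤ._+_ ℤ.0ℤ (L.map F xs)

  ∑-cong : ∀ xs {F G : A → ℤ} → (∀ x → F x ≡ G x) → ∑ xs F ≡ ∑ xs G
  ∑-cong xs F≗G = cong (foldr ℤ._+_ ℤ.0ℤ) (Lₚ.map-cong F≗G xs)

  ∑-zero : ∀ xs → ∑ xs (λ _ → ℤ.0ℤ) ≡ ℤ.0ℤ
  ∑-zero []       = refl
  ∑-zero (x ∷ xs) = trans (ℤₚ.+-identityˡ _) (∑-zero xs)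

  ∑-+ : ∀ xs (F G : A → ℤ) → ∑ xs (λ x → F x ℤ.+ G x) ≡ ∑ xs F ℤ.+ ∑ xs G
  ∑-+ []       F G = refl
  ∑-+ (x ∷ xs) F G = trans (cong (λ z → F x ℤ.+ G x ℤ.+ z) (∑-+ xs F G)) (interchange (F x) (G x) (∑ xs F) (∑ xs G))
    where
    interchange : ∀ a b c d → (a ℤ.+ b) ℤ.+ (c ℤ.+ d) ≡ (a ℤ.+ c) ℤ.+ (b ℤ.+ d)
    interchange = ℤ-Solver.solve-∀

  *-∑ : ∀ c xs (F : A → ℤ) → c ℤ.* ∑ xs F ≡ ∑ xs (λ x → c ℤ.* F x)
  *-∑ c []       F = ℤₚ.*-zeroʳ c
  *-∑ c (x ∷ xs) F = trans (ℤₚ.*-distribˡ-+ c (F x) _) (cong (λ z → c ℤ.* F x ℤ.+ z) (*-∑ c xs F))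

  ∑-const : ∀ xs c → ∑ xs (λ _ → c) ≡ ℤ.+ length xs ℤ.* c
  ∑-const []       c = refl
  ∑-const (x ∷ xs) c = trans (cong (λ z → c ℤ.+ z) (∑-const xs c)) (sym (ℤₚ.suc-* (ℤ.+ length xs) c))

  ∑-≤ : ∀ xs {F G : A → ℤ} → (∀ x → F x ℤ.≤ G x) → ∑ xs F ℤ.≤ ∑ xs G
  ∑-≤ []       F≤G = ℤₚ.≤-refl
  ∑-≤ (x ∷ xs) F≤G = ℤₚ.+-mono-≤ (F≤G x) (∑-≤ xs F≤G)

  ∑-< : ∀ {xs} {F G : A → ℤ} {a} → a ∈ xs → (∀ x → F x ℤ.≤ G x) → F a ℤ.< G a → ∑ xs F ℤ.< ∑ xs G
  ∑-< {x ∷ xs} (here refl) F≤G Fa<Ga = ℤₚ.+-mono-<-≤ Fa<Ga (∑-≤ xs F≤G)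
  ∑-< {x ∷ xs} (there a∈)  F≤G Fa<Ga = ℤₚ.+-mono-≤-< (F≤G x) (∑-< a∈ F≤G Fa<Ga)

  length-filter : {P : Pred A 0ℓ} (P? : Decidable P) → ∀ xs →
                  ℤ.+ length (filter P? xs) ≡ ∑ xs (λ x → if does (P? x) then ℤ.1ℤ else ℤ.0ℤ)
  length-filter P? []       = refl
  length-filter P? (x ∷ xs) with P? x
  ... | yes _ = cong (λ z → ℤ.1ℤ ℤ.+ z) (length-filter P? xs)
  ... | no  _ = trans (length-filter P? xs) (sym (ℤₚ.+-identityˡ _))

∑-swap : {A B : Set} (xs : List A) (ys : List B) (F : A → B → ℤ) →
         ∑ xs (λ x → ∑ ys (F x)) ≡ ∑ ys (λ y → ∑ xs (λ x → F x y))
∑-swap []       ys F = sym (∑-zero ys)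
∑-swap (x ∷ xs) ys F = trans (cong (λ z → ∑ ys (F x) ℤ.+ z) (∑-swap xs ys F)) (sym (∑-+ ys (F x) _))

module _ {A : Set} (E : Enumeration A) where

  open Enumeration E

  ∑-reindex : (f f⁻¹ : A → A) → (∀ x → f (f⁻¹ x) ≡ x) → (∀ x → f⁻¹ (f x) ≡ x) →
              (F : A → ℤ) → ∑ elements (F ∘ f) ≡ ∑ elements F
  ∑-reindex f f⁻¹ ff⁻¹ f⁻¹f F = trans (cong (foldr ℤ._+_ ℤ.0ℤ) (Lₚ.map-∘ elements))
    (foldr-↭ ℤₚ.+-0-isCommutativeMonoid (↭ₚ.map⁺ F (map-bijection-↭ E f f⁻¹ ff⁻¹ f⁻¹f)))

module _ {A : Set} (_≟_ : DecidableEquality A) where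

  δ : A → A → ℤ
  δ x y = if does (x ≟ y) then ℤ.1ℤ else ℤ.0ℤ

  δ-yes : ∀ {x y} → x ≡ y → δ x y ≡ ℤ.1ℤ
  δ-yes {x} {y} x≡y with x ≟ y
  ... | yes _   = refl
  ... | no  x≢y = contradiction x≡y x≢y

  δ-no : ∀ {x y} → x ≢ y → δ x y ≡ ℤ.0ℤ
  δ-no {x} {y} x≢y with x ≟ y
  ... | yes x≡y = contradiction x≡y x≢y
  ... | no  _   = refl

  δ-cong : ∀ {x y z w} → (x ≡ y → z ≡ w) → (z ≡ w → x ≡ y) → δ x y ≡ δ z w
  δ-cong {x} {y} f g with x ≟ y
  ... | yes x≡y = sym (δ-yes (f x≡y))
  ... | no  x≢y = sym (δ-no (x≢y ∘ g))

  δ-yes-* : ∀ {x y} c → x ≡ y → δ x y ℤ.* c ≡ c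
  δ-yes-* c x≡y = trans (cong (ℤ._* c) (δ-yes x≡y)) (ℤₚ.*-identityˡ c)

  δ-no-* : ∀ {x y} c → x ≢ y → δ x y ℤ.* c ≡ ℤ.0ℤ
  δ-no-* c x≢y = trans (cong (ℤ._* c) (δ-no x≢y)) (ℤₚ.*-zeroˡ c)

  ∑-δ-absent : ∀ {xs} a (F : A → ℤ) → All (a ≢_) xs → ∑ xs (λ x → δ a x ℤ.* F x) ≡ ℤ.0ℤ
  ∑-δ-absent a F []                    = refl
  ∑-δ-absent a F (_∷_ {x} a≢x a∉xs) = cong₂ ℤ._+_ (δ-no-* (F x) a≢x) (∑-δ-absent a F a∉xs)

  ∑-δ : ∀ {xs a} → Unique xs → a ∈ xs → (F : A → ℤ) → ∑ xs (λ x → δ a x ℤ.* F x) ≡ F a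
  ∑-δ {a = a} (a∉xs ∷ _) (here refl) F =
    trans (cong₂ ℤ._+_ (δ-yes-* (F a) refl) (∑-δ-absent a F a∉xs)) (ℤₚ.+-identityʳ (F a))
  ∑-δ {x ∷ xs} {a} (x∉xs ∷ u) (there a∈xs) F =
    trans (cong₂ ℤ._+_ (δ-no-* (F x) (All.lookup x∉xs a∈xs ∘ sym)) (∑-δ u a∈xs F)) (ℤₚ.+-identityˡ (F a))

IsConstant : {A : Set} → (A → ℤ) → Set
IsConstant u = ∀ j k → u j ≡ u k

∑-constant : {A K : Set} (xs : List A) {G : A → K → ℤ} → (∀ a → IsConstant (G a)) →
    IsConstant (λ k → ∑ xs (λ a → G a k))
∑-constant xs const j k = ∑-cong xs (λ a → const a j k)

-- Modulo constant vectors, a sum whose other terms all vanish reduces to the term at `a₀`.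
∑-isolate : {A K : Set} (_≟_ : DecidableEquality A) (E : Enumeration A) (a₀ : A) {G : A → K → ℤ} →
            (∀ a → a ≢ a₀ → IsConstant (G a)) →
            IsConstant (λ k → ∑ (Enumeration.elements E) (λ a → G a k) ℤ.- G a₀ k)
∑-isolate {A} {K} _≟_ E a₀ {G} const j k = begin
  ∑ elements (λ a → G a j) ℤ.- G a₀ j  ≡⟨ split j ⟨
  ∑ elements (rest j)                  ≡⟨ ∑-constant elements rest-const j k ⟩
  ∑ elements (rest k)                  ≡⟨ split k ⟩
  ∑ elements (λ a → G a k) ℤ.- G a₀ k  ∎
  where
  open ≡-Reasoning
  open Enumeration E
  -- The summand at `a₀` is cancelled in place by an indicator, so the list of summands need not
  -- change.
  rest : K → A → ℤ
  rest k a = G a k ℤ.+ δ _≟_ a₀ a ℤ.* (ℤ.- G a k)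
  rest-const : ∀ a → IsConstant (λ k → rest k a)
  rest-const a j k with a₀ ≟ a
  ... | yes _ = trans (cancel (G a j)) (sym (cancel (G a k)))
    where
    cancel : ∀ z → z ℤ.+ ℤ.1ℤ ℤ.* (ℤ.- z) ≡ ℤ.0ℤ
    cancel = ℤ-Solver.solve-∀
  ... | no a₀≢a = cong (λ z → z ℤ.+ ℤ.0ℤ ℤ.* (ℤ.- z)) (const a (λ a≡a₀ → a₀≢a (sym a≡a₀)) j k)
  split : ∀ k → ∑ elements (rest k) ≡ ∑ elements (λ a → G a k) ℤ.- G a₀ k
  split k =
    trans (∑-+ elements _ _)
      (cong (λ z → ∑ elements (λ a → G a k) ℤ.+ z) (∑-δ _≟_ unique (complete a₀) (λ a → ℤ.- G a k)))

-- The prime field F_p.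

module PrimeField (p : ℕ) {{_ : NonZero p}} where

  infixl 6 _+ᶠ_ _-ᶠ_
  infixl 7 _*ᶠ_
  _+ᶠ_ _*ᶠ_ _-ᶠ_ : Fp p → Fp p → Fp p
  _+ᶠ_ = _+ₚ_ p
  _*ᶠ_ = _*ₚ_ p
  _-ᶠ_ = _-ₚ_ p

  neg : Fp p → Fp p
  neg = negₚ p

  0ᶠ 1ᶠ : Fp p
  0ᶠ = 0ₚ p
  1ᶠ = 1ₚ p

  private
    ⟦_⟧ : ℕ → Fp p
    ⟦ m ⟧ = m mod p

    toℕ-⟦⟧ : ∀ m → toℕ ⟦ m ⟧ ≡ m % p
    toℕ-⟦⟧ m = Finₚ.toℕ-fromℕ< (m%n<n m p)

    ⟦⟧-cong : ∀ {m n} → m % p ≡ n % p → ⟦ m ⟧ ≡ ⟦ n ⟧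
    ⟦⟧-cong {m} {n} eq = Finₚ.toℕ-injective (trans (toℕ-⟦⟧ m) (trans eq (sym (toℕ-⟦⟧ n))))

    ⟦toℕ⟧ : ∀ a → ⟦ toℕ a ⟧ ≡ a
    ⟦toℕ⟧ a = Finₚ.toℕ-injective (trans (toℕ-⟦⟧ (toℕ a)) (m<n⇒m%n≡m (Finₚ.toℕ<n a)))

    ⟦⟧-+ : ∀ m n → ⟦ m ⟧ +ᶠ ⟦ n ⟧ ≡ ⟦ m ℕ.+ n ⟧
    ⟦⟧-+ m n = ⟦⟧-cong (trans (cong₂ (λ a b → (a ℕ.+ b) % p) (toℕ-⟦⟧ m) (toℕ-⟦⟧ n)) (sym (%-distribˡ-+ m n p)))

    ⟦⟧-* : ∀ m n → ⟦ m ⟧ *ᶠ ⟦ n ⟧ ≡ ⟦ m ℕ.* n ⟧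
    ⟦⟧-* m n = ⟦⟧-cong (trans (cong₂ (λ a b → (a ℕ.* b) % p) (toℕ-⟦⟧ m) (toℕ-⟦⟧ n)) (sym (%-distribˡ-* m n p)))

    ⟦p⟧ : ⟦ p ⟧ ≡ 0ᶠ
    ⟦p⟧ = ⟦⟧-cong {p} {0} (trans (n%n≡0 p) (sym (m*n%n≡0 0 p)))

    -- Replaces an inner residue by an unreduced representative; this is how associativity and
    -- distributivity descend from the naturals.
    +-⟦⟧ : ∀ a n → a +ᶠ ⟦ n ⟧ ≡ ⟦ toℕ a ℕ.+ n ⟧
    +-⟦⟧ a n = trans (cong (_+ᶠ ⟦ n ⟧) (sym (⟦toℕ⟧ a))) (⟦⟧-+ (toℕ a) n)

    *-⟦⟧ : ∀ a n → a *ᶠ ⟦ n ⟧ ≡ ⟦ toℕ a ℕ.* n ⟧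
    *-⟦⟧ a n = trans (cong (_*ᶠ ⟦ n ⟧) (sym (⟦toℕ⟧ a))) (⟦⟧-* (toℕ a) n)

  +ᶠ-comm : ∀ a b → a +ᶠ b ≡ b +ᶠ a
  +ᶠ-comm a b = cong ⟦_⟧ (ℕₚ.+-comm (toℕ a) (toℕ b))

  *ᶠ-comm : ∀ a b → a *ᶠ b ≡ b *ᶠ a
  *ᶠ-comm a b = cong ⟦_⟧ (ℕₚ.*-comm (toℕ a) (toℕ b))

  +ᶠ-assoc : ∀ a b c → (a +ᶠ b) +ᶠ c ≡ a +ᶠ (b +ᶠ c)
  +ᶠ-assoc a b c = begin
    (a +ᶠ b) +ᶠ c                       ≡⟨ +ᶠ-comm _ c ⟩
    c +ᶠ (a +ᶠ b)                       ≡⟨ +-⟦⟧ c (toℕ a ℕ.+ toℕ b) ⟩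
    ⟦ toℕ c ℕ.+ (toℕ a ℕ.+ toℕ b) ⟧     ≡⟨ cong ⟦_⟧ (trans (ℕₚ.+-comm (toℕ c) _) (ℕₚ.+-assoc (toℕ a) _ _)) ⟩
    ⟦ toℕ a ℕ.+ (toℕ b ℕ.+ toℕ c) ⟧     ≡⟨ +-⟦⟧ a (toℕ b ℕ.+ toℕ c) ⟨
    a +ᶠ (b +ᶠ c)                       ∎
    where open ≡-Reasoning

  *ᶠ-assoc : ∀ a b c → (a *ᶠ b) *ᶠ c ≡ a *ᶠ (b *ᶠ c)
  *ᶠ-assoc a b c = begin
    (a *ᶠ b) *ᶠ c                       ≡⟨ *ᶠ-comm _ c ⟩
    c *ᶠ (a *ᶠ b)                       ≡⟨ *-⟦⟧ c (toℕ a ℕ.* toℕ b) ⟩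
    ⟦ toℕ c ℕ.* (toℕ a ℕ.* toℕ b) ⟧     ≡⟨ cong ⟦_⟧ (trans (ℕₚ.*-comm (toℕ c) _) (ℕₚ.*-assoc (toℕ a) _ _)) ⟩
    ⟦ toℕ a ℕ.* (toℕ b ℕ.* toℕ c) ⟧     ≡⟨ *-⟦⟧ a (toℕ b ℕ.* toℕ c) ⟨
    a *ᶠ (b *ᶠ c)                       ∎
    where open ≡-Reasoning

  *ᶠ-distribˡ-+ᶠ : ∀ a b c → a *ᶠ (b +ᶠ c) ≡ (a *ᶠ b) +ᶠ (a *ᶠ c)
  *ᶠ-distribˡ-+ᶠ a b c = begin
    a *ᶠ (b +ᶠ c)                                    ≡⟨ *-⟦⟧ a (toℕ b ℕ.+ toℕ c) ⟩
    ⟦ toℕ a ℕ.* (toℕ b ℕ.+ toℕ c) ⟧                  ≡⟨ cong ⟦_⟧ (ℕₚ.*-distribˡ-+ (toℕ a) _ _) ⟩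
    ⟦ toℕ a ℕ.* toℕ b ℕ.+ toℕ a ℕ.* toℕ c ⟧          ≡⟨ ⟦⟧-+ _ _ ⟨
    (a *ᶠ b) +ᶠ (a *ᶠ c)                             ∎
    where open ≡-Reasoning

  +ᶠ-identityʳ : ∀ a → a +ᶠ 0ᶠ ≡ a
  +ᶠ-identityʳ a = trans (+-⟦⟧ a 0) (trans (cong ⟦_⟧ (ℕₚ.+-identityʳ (toℕ a))) (⟦toℕ⟧ a))

  *ᶠ-identityʳ : ∀ a → a *ᶠ 1ᶠ ≡ a
  *ᶠ-identityʳ a = trans (*-⟦⟧ a 1) (trans (cong ⟦_⟧ (ℕₚ.*-identityʳ (toℕ a))) (⟦toℕ⟧ a))

  +ᶠ-inverseʳ : ∀ a → a +ᶠ (neg a) ≡ 0ᶠ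
  +ᶠ-inverseʳ a = trans (+-⟦⟧ a _) (trans (cong ⟦_⟧ (ℕₚ.m+[n∸m]≡n (Finₚ.toℕ≤n a))) ⟦p⟧)

  -ᶠ-def : ∀ a b → a -ᶠ b ≡ a +ᶠ (neg b)
  -ᶠ-def a b = sym (+-⟦⟧ a _)

  opaque
    isCommutativeRing : IsCommutativeRing _≡_ _+ᶠ_ _*ᶠ_ neg 0ᶠ 1ᶠ
    isCommutativeRing = record
      { isRing = record
        { +-isAbelianGroup = record
          { isGroup = record
            { isMonoid = record
              { isSemigroup = record
                { isMagma = isMagma _+ᶠ_
                ; assoc = +ᶠ-assoc }
              ; identity = (λ a → trans (+ᶠ-comm 0ᶠ a) (+ᶠ-identityʳ a)) , +ᶠ-identityʳ }
            ; inverse = (λ a → trans (+ᶠ-comm _ a) (+ᶠ-inverseʳ a)) , +ᶠ-inverseʳ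
            ; ⁻¹-cong = cong neg }
          ; comm = +ᶠ-comm }
        ; *-cong = cong₂ _*ᶠ_
        ; *-assoc = *ᶠ-assoc
        ; *-identity = (λ a → trans (*ᶠ-comm 1ᶠ a) (*ᶠ-identityʳ a)) , *ᶠ-identityʳ
        ; distrib =
          *ᶠ-distribˡ-+ᶠ , λ a b c → trans (*ᶠ-comm _ a)
            (trans (*ᶠ-distribˡ-+ᶠ a b c) (cong₂ _+ᶠ_ (*ᶠ-comm a b) (*ᶠ-comm a c)))
        }
      ; *-comm = *ᶠ-comm
      }

  open RingSolver isCommutativeRing public using (ring)
  open RingIdentities isCommutativeRing -ᶠ-def public

  open Algebra.Definitions.RawMonoid (CommutativeRing.+-rawMonoid ring) public
    using () renaming (_×_ to _×ᶠ_)

  ×ᶠ-mod : ∀ m a → m ×ᶠ a ≡ (m mod p) *ᶠ a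
  ×ᶠ-mod zero    a = trans (cong ⟦_⟧ (sym (ℕₚ.*-zeroʳ (toℕ a)))) (trans (sym (*-⟦⟧ a 0)) (*ᶠ-comm a _))
  ×ᶠ-mod (suc m) a = begin
    a +ᶠ (m ×ᶠ a)                                ≡⟨ cong (a +ᶠ_) (trans (×ᶠ-mod m a) (*ᶠ-comm _ a)) ⟩
    a +ᶠ a *ᶠ ⟦ m ⟧                              ≡⟨ cong (a +ᶠ_) (*-⟦⟧ a m) ⟩
    a +ᶠ ⟦ toℕ a ℕ.* m ⟧                         ≡⟨ +-⟦⟧ a _ ⟩
    ⟦ toℕ a ℕ.+ toℕ a ℕ.* m ⟧                    ≡⟨ cong ⟦_⟧ (ℕₚ.*-suc (toℕ a) m) ⟨
    ⟦ toℕ a ℕ.* suc m ⟧                          ≡⟨ *-⟦⟧ a (suc m) ⟨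
    a *ᶠ ⟦ suc m ⟧                               ≡⟨ *ᶠ-comm a _ ⟩
    ⟦ suc m ⟧ *ᶠ a                               ∎
    where open ≡-Reasoning

  characteristic : ∀ a → p ×ᶠ a ≡ 0ᶠ
  characteristic a =
    trans (×ᶠ-mod p a) (trans (cong (_*ᶠ a) ⟦p⟧)
      (trans (*ᶠ-comm 0ᶠ a) (trans (*-⟦⟧ a 0) (cong ⟦_⟧ (ℕₚ.*-zeroʳ (toℕ a))))))

  module _ (pp : Prime p) where

    1ᶠ≢0ᶠ : 1ᶠ ≢ 0ᶠ
    1ᶠ≢0ᶠ 1≡0 =
      contradiction (trans (sym (m<n⇒m%n≡m 1<p))
        (trans (sym (toℕ-⟦⟧ 1)) (trans (cong toℕ 1≡0) (trans (toℕ-⟦⟧ 0) (m*n%n≡0 0 p))))) λ ()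
      where
      1<p : 1 ℕ.< p
      1<p = ℕ.nonTrivial⇒n>1 p {{prime⇒nonTrivial pp}}

    ᶠ-inverse : ∀ a → a ≢ 0ᶠ → ∃ λ b → b *ᶠ a ≡ 1ᶠ
    ᶠ-inverse a a≢0 with coprime-Bézout (prime⇒coprime pp {{toℕa≢0}} (Finₚ.toℕ<n a))
      where
      toℕa≢0 : NonZero (toℕ a)
      toℕa≢0 = ℕ.≢-nonZero (λ eq → a≢0 (trans (sym (⟦toℕ⟧ a)) (cong ⟦_⟧ eq)))
    ... | GCD.Bézout.-+ x y eq = ⟦ y ⟧ , trans (*ᶠ-comm ⟦ y ⟧ a) (trans (*-⟦⟧ a y)
            (⟦⟧-cong {toℕ a ℕ.* y} {1} (trans (cong (_% p) (trans (ℕₚ.*-comm (toℕ a) y) (sym eq))) ([m+kn]%n≡m%n 1 x p))))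
    -- Over the naturals this case of Bézout reads 1 + y a = x p, so the inverse is -y.
    ... | GCD.Bézout.+- x y eq = neg ⟦ y ⟧ , (begin
            (neg ⟦ y ⟧) *ᶠ a          ≡⟨ -‿distribˡ-* ⟦ y ⟧ a ⟨
            neg (⟦ y ⟧ *ᶠ a)          ≡⟨ +-inverseˡ-unique 1ᶠ (⟦ y ⟧ *ᶠ a) 1+ya≡0 ⟨
            1ᶠ                       ∎)
      where
      open ≡-Reasoning
      open Algebra.Properties.Ring (CommutativeRing.ring ring) using (-‿distribˡ-*; +-inverseˡ-unique)
      1+ya≡0 : 1ᶠ +ᶠ (⟦ y ⟧ *ᶠ a) ≡ 0ᶠ
      1+ya≡0 = begin
        1ᶠ +ᶠ (⟦ y ⟧ *ᶠ a)
          ≡⟨ cong (1ᶠ +ᶠ_) (trans (*ᶠ-comm ⟦ y ⟧ a) (trans (*-⟦⟧ a y) (cong ⟦_⟧ (ℕₚ.*-comm (toℕ a) y)))) ⟩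
        ⟦ 1 ⟧ +ᶠ ⟦ y ℕ.* toℕ a ⟧    ≡⟨ ⟦⟧-+ 1 _ ⟩
        ⟦ 1 ℕ.+ y ℕ.* toℕ a ⟧       ≡⟨ cong ⟦_⟧ eq ⟩
        ⟦ x ℕ.* p ⟧                 ≡⟨ ⟦⟧-cong {x ℕ.* p} {0} (trans (m*n%n≡0 x p) (sym (m*n%n≡0 0 p))) ⟩
        0ᶠ                          ∎

    -- A group of prime order is generated by each nonzero element. This spreads invariance under
    -- one shift to all coefficients in `balanced`.
    multiples : ∀ {a} → a ≢ 0ᶠ → ∀ c → ∃ λ m → m ×ᶠ a ≡ c
    multiples {a} a≢0 c with b , ba≡1 ← ᶠ-inverse a a≢0 = toℕ (c *ᶠ b) , (begin
      toℕ (c *ᶠ b) ×ᶠ a          ≡⟨ ×ᶠ-mod _ a ⟩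
      ⟦ toℕ (c *ᶠ b) ⟧ *ᶠ a      ≡⟨ cong (_*ᶠ a) (⟦toℕ⟧ (c *ᶠ b)) ⟩
      c *ᶠ b *ᶠ a                ≡⟨ *ᶠ-assoc c b a ⟩
      c *ᶠ (b *ᶠ a)              ≡⟨ cong (c *ᶠ_) ba≡1 ⟩
      c *ᶠ 1ᶠ                    ≡⟨ *ᶠ-identityʳ c ⟩
      c                          ∎)
      where open ≡-Reasoning

-- Coordinate vectors and the quotient ring F_p[X]/(g).

module VectorSpace (p : ℕ) {{_ : NonZero p}} where

  open PrimeField p
  private module F = CommutativeRing ring

  infixl 6 _⊹_
  infixr 8 _•_

  _⊹_ : ∀ {n} → V p n → V p n → V p n
  _⊹_ = _⊕_ p

  0ⱽ : ∀ {n} → V p n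
  0ⱽ = zeroV p

  _•_ : ∀ {n} → Fp p → V p n → V p n
  c • v = V.map (c *ᶠ_) v

  negⱽ : ∀ {n} → V p n → V p n
  negⱽ = V.map neg

  ⊹-isAbelianGroup : ∀ {n} → IsAbelianGroup {A = V p n} _≡_ _⊹_ 0ⱽ negⱽ
  ⊹-isAbelianGroup = record
    { isGroup = record
      { isMonoid = record
        { isSemigroup = record
          { isMagma = isMagma _⊹_
          ; assoc = Vₚ.zipWith-assoc F.+-assoc }
        ; identity = Vₚ.zipWith-identityˡ F.+-identityˡ , Vₚ.zipWith-identityʳ F.+-identityʳ }
      ; inverse = Vₚ.zipWith-inverseˡ F.-‿inverseˡ , Vₚ.zipWith-inverseʳ F.-‿inverseʳ
      ; ⁻¹-cong = cong negⱽ }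
    ; comm = Vₚ.zipWith-comm F.+-comm }

  private module G {n} = IsAbelianGroup (⊹-isAbelianGroup {n})

  •-distribˡ : ∀ {n} c (u v : V p n) → c • (u ⊹ v) ≡ c • u ⊹ c • v
  •-distribˡ c []      []      = refl
  •-distribˡ c (a ∷ u) (b ∷ v) = cong₂ _∷_ (F.distribˡ c a b) (•-distribˡ c u v)

  •-distribʳ : ∀ {n} (v : V p n) a b → (a +ᶠ b) • v ≡ a • v ⊹ b • v
  •-distribʳ []      a b = refl
  •-distribʳ (c ∷ v) a b = cong₂ _∷_ (F.distribʳ c a b) (•-distribʳ v a b)

  •-assoc : ∀ {n} a b (v : V p n) → (a *ᶠ b) • v ≡ a • b • v
  •-assoc a b []      = refl
  •-assoc a b (c ∷ v) = cong₂ _∷_ (F.*-assoc a b c) (•-assoc a b v)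

  •-zeroʳ : ∀ {n} c → c • 0ⱽ {n} ≡ 0ⱽ
  •-zeroʳ {zero}  c = refl
  •-zeroʳ {suc n} c = cong₂ _∷_ (F.zeroʳ c) (•-zeroʳ c)

  •-zeroˡ : ∀ {n} (v : V p n) → 0ᶠ • v ≡ 0ⱽ
  •-zeroˡ []      = refl
  •-zeroˡ (c ∷ v) = cong₂ _∷_ (F.zeroˡ c) (•-zeroˡ v)

  •-identityˡ : ∀ {n} (v : V p n) → 1ᶠ • v ≡ v
  •-identityˡ []      = refl
  •-identityˡ (c ∷ v) = cong₂ _∷_ (F.*-identityˡ c) (•-identityˡ v)

  •-comm : ∀ {n} a b (v : V p n) → a • b • v ≡ b • a • v
  •-comm a b v = trans (sym (•-assoc a b v)) (trans (cong (_• v) (F.*-comm a b)) (•-assoc b a v))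

  ⊹-interchange : ∀ {n} (u v w z : V p n) → (u ⊹ v) ⊹ (w ⊹ z) ≡ (u ⊹ w) ⊹ (v ⊹ z)
  ⊹-interchange [] [] [] [] = refl
  ⊹-interchange (a ∷ u) (b ∷ v) (c ∷ w) (d ∷ z) =
    cong₂ _∷_ (interchange a b c d) (⊹-interchange u v w z)

  init-⊹ : ∀ {m} (u v : V p (suc m)) → init (u ⊹ v) ≡ init u ⊹ init v
  init-⊹ (a ∷ [])         (b ∷ [])         = refl
  init-⊹ (a ∷ u@(_ ∷ _)) (b ∷ v@(_ ∷ _)) = cong (a +ᶠ b ∷_) (init-⊹ u v)

  last-⊹ : ∀ {m} (u v : V p (suc m)) → last (u ⊹ v) ≡ last u +ᶠ last v
  last-⊹ (a ∷ [])         (b ∷ [])         = refl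
  last-⊹ (a ∷ u@(_ ∷ _)) (b ∷ v@(_ ∷ _)) = last-⊹ u v

  init-• : ∀ {m} c (v : V p (suc m)) → init (c • v) ≡ c • init v
  init-• c (b ∷ [])        = refl
  init-• c (b ∷ v@(_ ∷ _)) = cong (c *ᶠ b ∷_) (init-• c v)

  last-• : ∀ {m} c (v : V p (suc m)) → last (c • v) ≡ c *ᶠ last v
  last-• c (b ∷ [])        = refl
  last-• c (b ∷ v@(_ ∷ _)) = last-• c v

  private
    -- Reduction modulo the monic polynomial: an overflowing l X^n becomes -l g. Separated from the
    -- shift in `mulX`, it can be treated coordinate by coordinate.
    reduce : ∀ {m} → V p m → V p m → Fp p → V p m
    reduce g v l = zipWith _-ᶠ_ v (l • g)

    reduce-⊹ : ∀ {m} (g u v : V p m) l k → reduce g (u ⊹ v) (l +ᶠ k) ≡ reduce g u l ⊹ reduce g v k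
    reduce-⊹ []      []      []      l k = refl
    reduce-⊹ (c ∷ g) (a ∷ u) (b ∷ v) l k = cong₂ _∷_ (∸-mul-+ a b c l k) (reduce-⊹ g u v l k)

    reduce-• : ∀ {m} (g v : V p m) c l → reduce g (c • v) (c *ᶠ l) ≡ c • reduce g v l
    reduce-• []      []      c l = refl
    reduce-• (b ∷ g) (a ∷ v) c l = cong₂ _∷_ (∸-mul-* a b c l) (reduce-• g v c l)

    reduce-0 : ∀ {m} (g v : V p m) → reduce g v 0ᶠ ≡ v
    reduce-0 []      []      = refl
    reduce-0 (b ∷ g) (a ∷ v) = cong₂ _∷_ (∸-mul-0 a b) (reduce-0 g v)

  mulX-⊹ : ∀ {m} (g u v : V p m) → mulX p g (u ⊹ v) ≡ mulX p g u ⊹ mulX p g v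
  mulX-⊹ {zero}  g u v = refl
  mulX-⊹ {suc m} g u v = trans
    (cong₂ (reduce g) (cong₂ _∷_ (sym (F.+-identityˡ 0ᶠ)) (init-⊹ u v)) (last-⊹ u v))
    (reduce-⊹ g (0ᶠ ∷ init u) (0ᶠ ∷ init v) (last u) (last v))

  mulX-• : ∀ {m} (g : V p m) c v → mulX p g (c • v) ≡ c • mulX p g v
  mulX-• {zero}  g c [] = refl
  mulX-• {suc m} g c v = trans
    (cong₂ (reduce g) (cong₂ _∷_ (sym (F.zeroʳ c)) (init-• c v)) (last-• c v))
    (reduce-• g (0ᶠ ∷ init v) c (last v))

  pad : ∀ {k n} → k ℕ.≤ n → Vec (Fp p) k → V p n
  pad z≤n       []       = 0ⱽ
  pad (s≤s k≤n) (a ∷ as) = a ∷ pad k≤n as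

  pad-full : ∀ {n} (n≤n : n ℕ.≤ n) as → pad n≤n as ≡ as
  pad-full z≤n       []       = refl
  pad-full (s≤s n≤n) (a ∷ as) = cong (a ∷_) (pad-full n≤n as)

  last-0ⱽ : ∀ n → last (0ⱽ {suc n}) ≡ 0ᶠ
  last-0ⱽ zero    = refl
  last-0ⱽ (suc n) = last-0ⱽ n

  init-0ⱽ : ∀ n → init (0ⱽ {suc n}) ≡ 0ⱽ
  init-0ⱽ zero    = refl
  init-0ⱽ (suc n) = cong (0ᶠ ∷_) (init-0ⱽ n)

  last-pad : ∀ {k n} (k≤n : k ℕ.≤ n) (k≤1+n : k ℕ.≤ suc n) as → last (pad k≤1+n as) ≡ 0ᶠ
  last-pad {n = n} z≤n   z≤n           []       = last-0ⱽ n
  last-pad (s≤s k≤n)     (s≤s k≤1+n)   (a ∷ as) = last-pad k≤n k≤1+n as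

  init-pad : ∀ {k n} (k≤n : k ℕ.≤ n) (k≤1+n : k ℕ.≤ suc n) as → init (pad k≤1+n as) ≡ pad k≤n as
  init-pad {n = n} z≤n   z≤n           []       = init-0ⱽ n
  init-pad (s≤s k≤n)     (s≤s k≤1+n)   (a ∷ as) = cong (a ∷_) (init-pad k≤n k≤1+n as)

  -- Evaluating by Horner's scheme at 1, each intermediate polynomial still has room before degree
  -- n. Its last coordinate is 0, so no reduction takes place and the coefficients reappear
  -- unchanged.
  mul'-oneV : ∀ {k n} (g : V p n) (k≤n : k ℕ.≤ n) as → mul' p g as (oneV p) ≡ pad k≤n as
  mul'-oneV           g z≤n       []       = refl
  mul'-oneV {suc k} {suc n} g (s≤s k≤n) (a ∷ as) = begin
    a • oneV p ⊹ mulX p g (mul' p g as (oneV p))    ≡⟨ cong (λ v → a • oneV p ⊹ mulX p g v) (mul'-oneV g k≤1+n as) ⟩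
    a • oneV p ⊹ mulX p g (pad k≤1+n as)
      ≡⟨ cong (a • oneV p ⊹_)
        (trans (cong₂ (λ v l → zipWith _-ᶠ_ (0ᶠ ∷ v) (l • g)) (init-pad k≤n k≤1+n as) (last-pad k≤n k≤1+n as))
        (reduce-0 g (0ᶠ ∷ pad k≤n as))) ⟩
    a • oneV p ⊹ (0ᶠ ∷ pad k≤n as)
      ≡⟨ cong₂ _∷_ (trans (F.+-identityʳ _) (F.*-identityʳ a))
        (trans (cong (_⊹ pad k≤n as) (•-zeroʳ a)) (G.identityˡ _)) ⟩
    a ∷ pad k≤n as                               ∎
    where
    open ≡-Reasoning
    k≤1+n = ℕₚ.m≤n⇒m≤1+n k≤n

-- Writing T for multiplication by X, the vector a = (a_0, …, a_(n-1)) acts as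
-- the operator Σ a_i T^i.  These operators commute and a is recovered as the
-- image of 1, which gives commutativity and associativity of the product.
module QuotientRing (p : ℕ) {{_ : NonZero p}} {n : ℕ} (g : V p n) where

  open PrimeField p
  open VectorSpace p
  private
    module F = CommutativeRing ring
    module G {n} = IsAbelianGroup (⊹-isAbelianGroup {n})

  T : V p n → V p n
  T = mulX p g

  act : ∀ {k} → Vec (Fp p) k → V p n → V p n
  act = mul' p g

  T-⊹ : ∀ u v → T (u ⊹ v) ≡ T u ⊹ T v
  T-⊹ = mulX-⊹ g

  T-• : ∀ c v → T (c • v) ≡ c • T v
  T-• = mulX-• g

  T-0 : T 0ⱽ ≡ 0ⱽ
  T-0 = trans (cong T (sym (•-zeroˡ 0ⱽ))) (trans (T-• 0ᶠ 0ⱽ) (•-zeroˡ _))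

  act-⊹ : ∀ {k} (as : Vec (Fp p) k) u v → act as (u ⊹ v) ≡ act as u ⊹ act as v
  act-⊹ []       u v = sym (G.identityˡ 0ⱽ)
  act-⊹ (a ∷ as) u v = trans
    (cong₂ _⊹_ (•-distribˡ a u v) (trans (cong T (act-⊹ as u v)) (T-⊹ _ _)))
    (⊹-interchange _ _ _ _)

  act-• : ∀ {k} (as : Vec (Fp p) k) c v → act as (c • v) ≡ c • act as v
  act-• []       c v = sym (•-zeroʳ c)
  act-• (a ∷ as) c v = trans
    (cong₂ _⊹_ (•-comm a c v) (trans (cong T (act-• as c v)) (T-• c _)))
    (sym (•-distribˡ c _ _))

  act-T : ∀ {k} (as : Vec (Fp p) k) v → act as (T v) ≡ T (act as v)
  act-T []       v = sym T-0
  act-T (a ∷ as) v = trans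
    (cong₂ _⊹_ (sym (T-• a v)) (cong T (act-T as v)))
    (sym (T-⊹ _ _))

  act-0 : ∀ {k} (as : Vec (Fp p) k) → act as 0ⱽ ≡ 0ⱽ
  act-0 as = trans (cong (act as) (sym (•-zeroˡ 0ⱽ))) (trans (act-• as 0ᶠ 0ⱽ) (•-zeroˡ _))

  act-comm : ∀ {k l} (as : Vec (Fp p) k) (bs : Vec (Fp p) l) v → act as (act bs v) ≡ act bs (act as v)
  act-comm []       bs v = sym (act-0 bs)
  act-comm (a ∷ as) bs v = sym (trans (act-⊹ bs _ _) (cong₂ _⊹_ (act-• bs a v)
    (trans (act-T bs _) (cong T (sym (act-comm as bs v))))))

  act-+ : ∀ {k} (as bs : Vec (Fp p) k) v → act (as ⊹ bs) v ≡ act as v ⊹ act bs v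
  act-+ []       []       v = sym (G.identityˡ 0ⱽ)
  act-+ (a ∷ as) (b ∷ bs) v = trans
    (cong₂ _⊹_ (•-distribʳ v a b) (trans (cong T (act-+ as bs v)) (T-⊹ _ _)))
    (⊹-interchange _ _ _ _)

  infixl 7 _⊛_
  _⊛_ : V p n → V p n → V p n
  _⊛_ = fmul p g

  1ⱽ : V p n
  1ⱽ = oneV p

  ⊛-identityʳ : ∀ a → a ⊛ 1ⱽ ≡ a
  ⊛-identityʳ a = trans (mul'-oneV g ℕₚ.≤-refl a) (pad-full ℕₚ.≤-refl a)

  ⊛-comm : ∀ a b → a ⊛ b ≡ b ⊛ a
  ⊛-comm a b = begin
    act a b               ≡⟨ cong (act a) (⊛-identityʳ b) ⟨
    act a (act b 1ⱽ)      ≡⟨ act-comm a b 1ⱽ ⟩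
    act b (act a 1ⱽ)      ≡⟨ cong (act b) (⊛-identityʳ a) ⟩
    act b a               ∎
    where open ≡-Reasoning

  ⊛-assoc : ∀ a b c → (a ⊛ b) ⊛ c ≡ a ⊛ (b ⊛ c)
  ⊛-assoc a b c = begin
    (a ⊛ b) ⊛ c           ≡⟨ ⊛-comm (a ⊛ b) c ⟩
    c ⊛ (a ⊛ b)           ≡⟨ act-comm c a b ⟩
    a ⊛ (c ⊛ b)           ≡⟨ cong (act a) (⊛-comm c b) ⟩
    a ⊛ (b ⊛ c)           ∎
    where open ≡-Reasoning

  opaque
    ⊛-isCommutativeRing : IsCommutativeRing _≡_ _⊹_ _⊛_ negⱽ 0ⱽ 1ⱽ
    ⊛-isCommutativeRing = record
      { isRing = record
        { +-isAbelianGroup = ⊹-isAbelianGroup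
        ; *-cong = cong₂ _⊛_
        ; *-assoc = ⊛-assoc
        ; *-identity = (λ a → trans (⊛-comm 1ⱽ a) (⊛-identityʳ a)) , ⊛-identityʳ
        ; distrib = act-⊹ , λ a b c → act-+ b c a
        }
      ; *-comm = ⊛-comm
      }

-- Binomial coefficients modulo a prime.

[1+k]*[1+n]C[1+k]≡[1+n]*nCk : ∀ n k → suc k ℕ.* (suc n C suc k) ≡ suc n ℕ.* (n C k)
[1+k]*[1+n]C[1+k]≡[1+n]*nCk n zero = trans (ℕₚ.*-identityˡ _) (trans (nC1≡n (suc n)) (sym (ℕₚ.*-identityʳ (suc n))))
[1+k]*[1+n]C[1+k]≡[1+n]*nCk zero (suc k) =
  trans (cong (suc (suc k) ℕ.*_) (k>n⇒nCk≡0 {1} {suc (suc k)} (s<s z<s))) (trans (ℕₚ.*-zeroʳ (suc (suc k))) (sym (cong (1 ℕ.*_) (k>n⇒nCk≡0 {0} {suc k} z<s))))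
[1+k]*[1+n]C[1+k]≡[1+n]*nCk (suc n) (suc k) = begin
  suc (suc k) ℕ.* (suc (suc n) C suc (suc k))
    ≡⟨ cong (suc (suc k) ℕ.*_) (nCk+nC[k+1]≡[n+1]C[k+1] (suc n) (suc k)) ⟨
  suc (suc k) ℕ.* (C₁ ℕ.+ suc n C suc (suc k))
    ≡⟨ split (suc k) C₁ _ ⟩
  C₁ ℕ.+ (suc k ℕ.* C₁ ℕ.+ suc (suc k) ℕ.* (suc n C suc (suc k)))
    ≡⟨ cong₂ (λ a b → C₁ ℕ.+ (a ℕ.+ b)) ([1+k]*[1+n]C[1+k]≡[1+n]*nCk n k) ([1+k]*[1+n]C[1+k]≡[1+n]*nCk n (suc k)) ⟩
  C₁ ℕ.+ (suc n ℕ.* (n C k) ℕ.+ suc n ℕ.* (n C suc k))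
    ≡⟨ cong (C₁ ℕ.+_) (ℕₚ.*-distribˡ-+ (suc n) (n C k) (n C suc k)) ⟨
  C₁ ℕ.+ suc n ℕ.* (n C k ℕ.+ n C suc k)
    ≡⟨ cong (λ c → C₁ ℕ.+ suc n ℕ.* c) (nCk+nC[k+1]≡[n+1]C[k+1] n k) ⟩
  suc (suc n) ℕ.* C₁ ∎
  where
  open ≡-Reasoning
  C₁ = suc n C suc k
  split : ∀ j a b → suc j ℕ.* (a ℕ.+ b) ≡ a ℕ.+ (j ℕ.* a ℕ.+ suc j ℕ.* b)
  split = ℕ-Solver.solve-∀

-- The prime divides k C(p,k) = p C(p-1,k-1), but not k, since 0 < k < p.
prime∣C : ∀ {p k} → Prime p → 0 ℕ.< k → k ℕ.< p → p ∣ p C k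
prime∣C {suc p} {suc k} pp _ k<p
  with euclidsLemma (suc k) (suc p C suc k) pp (subst (suc p ∣_) (sym ([1+k]*[1+n]C[1+k]≡[1+n]*nCk p k)) (m∣m*n (p C k)))
... | inj₁ p∣k = contradiction p∣k (>⇒∤ k<p)
... | inj₂ p∣C = p∣C

-- Finite fields: Fermat's theorem and root counting.

module FiniteField
  {A : Set} {_+_ _*_ : Op₂ A} { -_ : Op₁ A} {0# 1# : A}
  (isCR : IsCommutativeRing _≡_ _+_ _*_ -_ 0# 1#)
  (1≢0 : 1# ≢ 0#)
  (inverse : ∀ a → a ≢ 0# → ∃ λ b → a * b ≡ 1#)
  (_≟_ : DecidableEquality A)
  (E : Enumeration A)
  where

  open RingSolver isCR
  private module R = CommutativeRing ring
  open R using (_-_)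
  open Algebra.Properties.Semiring.Exp R.semiring using (_^_; ^-assocʳ)
  open Algebra.Properties.Semiring.Mult R.semiring using (×-assocˡ; ×-assoc-*) renaming (_×_ to _∙_)
  open Enumeration E

  *-cancelˡ-nonZero : ∀ a b c → a ≢ 0# → a * b ≡ a * c → b ≡ c
  *-cancelˡ-nonZero a b c a≢0 ab≡ac with a⁻¹ , aa⁻¹≡1 ← inverse a a≢0 = begin
    b                ≡⟨ undo b ⟨
    a⁻¹ * (a * b)    ≡⟨ cong (a⁻¹ *_) ab≡ac ⟩
    a⁻¹ * (a * c)    ≡⟨ undo c ⟩
    c                ∎
    where
    open ≡-Reasoning
    undo : ∀ b → a⁻¹ * (a * b) ≡ b
    undo b = trans (sym (R.*-assoc a⁻¹ a b)) (trans (cong (_* b) (trans (R.*-comm a⁻¹ a) aa⁻¹≡1)) (R.*-identityˡ b))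

  *-nonZero : ∀ {a b} → a ≢ 0# → b ≢ 0# → a * b ≢ 0#
  *-nonZero {a} {b} a≢0 b≢0 ab≡0 = b≢0 (*-cancelˡ-nonZero a b 0# a≢0 (trans ab≡0 (sym (R.zeroʳ a))))

  product : List A → A
  product = foldr _*_ 1#

  product-map-* : ∀ a xs → product (L.map (a *_) xs) ≡ (a ^ length xs) * product xs
  product-map-* a []       = sym (R.*-identityˡ 1#)
  product-map-* a (x ∷ xs) = trans (cong ((a * x) *_) (product-map-* a xs))
    (solve 4 (λ a x b c → (a :* x) :* (b :* c) := (a :* b) :* (x :* c)) refl a x (a ^ length xs) (product xs))

  product-nonZero : ∀ {xs} → All (_≢ 0#) xs → product xs ≢ 0#
  product-nonZero []             = 1≢0
  product-nonZero (x≢0 ∷ xs≢0) = *-nonZero x≢0 (product-nonZero xs≢0)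

  private
    nonZeros : List A
    nonZeros = filter (λ x → ¬? (x ≟ 0#)) elements

    nonZeros-unique : Unique nonZeros
    nonZeros-unique = Uniqueₚ.filter⁺ (λ x → ¬? (x ≟ 0#)) unique

    ∈-nonZeros : ∀ {x} → x ≢ 0# → x ∈ nonZeros
    ∈-nonZeros x≢0 = ∈-filter⁺ (λ x → ¬? (x ≟ 0#)) (complete _) x≢0

    nonZeros-≢0 : ∀ {x} → x ∈ nonZeros → x ≢ 0#
    nonZeros-≢0 x∈ = proj₂ (∈-filter⁻ (λ x → ¬? (x ≟ 0#)) {xs = elements} x∈)

    elements-↭ : elements ↭ 0# ∷ nonZeros
    elements-↭ = sameElements⇒↭ unique (All.tabulate (λ x∈ 0≡x → nonZeros-≢0 x∈ (sym 0≡x)) ∷ nonZeros-unique)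
      (mk⇔ (λ _ → split _) (λ _ → complete _))
      where
      split : ∀ x → x ∈ 0# ∷ nonZeros
      split x with x ≟ 0#
      ... | yes x≡0 = here x≡0
      ... | no  x≢0 = there (∈-nonZeros x≢0)

    scale-↭ : ∀ a → a ≢ 0# → L.map (a *_) nonZeros ↭ nonZeros
    scale-↭ a a≢0 =
      sameElements⇒↭ (Uniqueₚ.map⁺ (λ {x} {y} → *-cancelˡ-nonZero a x y a≢0) nonZeros-unique) nonZeros-unique
      (mk⇔ to from)
      where
      to : ∀ {x} → x ∈ L.map (a *_) nonZeros → x ∈ nonZeros
      to x∈ with y , y∈ , refl ← ∈-map⁻ (a *_) x∈ = ∈-nonZeros (*-nonZero a≢0 (nonZeros-≢0 y∈))
      from : ∀ {x} → x ∈ nonZeros → x ∈ L.map (a *_) nonZeros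
      from {x} x∈ with a⁻¹ , aa⁻¹≡1 ← inverse a a≢0 =
        subst (_∈ _) a[a⁻¹x]≡x (∈-map⁺ (a *_) (∈-nonZeros λ a⁻¹x≡0 →
          nonZeros-≢0 x∈ (trans (sym a[a⁻¹x]≡x) (trans (cong (a *_) a⁻¹x≡0) (R.zeroʳ a)))))
        where
        a[a⁻¹x]≡x : a * (a⁻¹ * x) ≡ x
        a[a⁻¹x]≡x = trans (sym (R.*-assoc a a⁻¹ x)) (trans (cong (_* x) aa⁻¹≡1) (R.*-identityˡ x))

  -- Multiplication by a permutes the nonzero elements, so their product P satisfies a^N P = P with
  -- N their number; P is nonzero and cancels.
  ^-length-nonZeros : ∀ a → a ≢ 0# → a ^ length nonZeros ≡ 1#
  ^-length-nonZeros a a≢0 =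
    *-cancelˡ-nonZero (product nonZeros) _ 1# (product-nonZero (All.tabulate nonZeros-≢0)) (begin
    product nonZeros * (a ^ length nonZeros)   ≡⟨ R.*-comm _ _ ⟩
    (a ^ length nonZeros) * product nonZeros   ≡⟨ product-map-* a nonZeros ⟨
    product (L.map (a *_) nonZeros)            ≡⟨ foldr-↭ R.*-isCommutativeMonoid (scale-↭ a a≢0) ⟩
    product nonZeros                           ≡⟨ R.*-identityʳ _ ⟨
    product nonZeros * 1#                      ∎)
    where open ≡-Reasoning

  fermat : ∀ a → a ^ length elements ≡ a
  fermat a = trans (cong (a ^_) (↭ₚ.↭-length elements-↭)) (go (a ≟ 0#))
    where
    go : Dec (a ≡ 0#) → a * (a ^ length nonZeros) ≡ a
    go (yes refl) = R.zeroˡ _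
    go (no a≢0)   = trans (cong (a *_) (^-length-nonZeros a a≢0)) (R.*-identityʳ a)

  -- Polynomial functions in Horner form, the leading coefficient 1 being the innermost term. The
  -- number is the degree of one representing polynomial; over a finite field the function does not
  -- determine it.
  Monic : ℕ → (A → A) → Set
  Monic zero    h = ∀ z → h z ≡ 1#
  Monic (suc d) h = ∃ λ c → ∃ λ k → Monic d k × (∀ z → h z ≡ c + (z * k z))

  monic-^ : ∀ d → Monic d (_^ d)
  monic-^ zero    = λ z → refl
  monic-^ (suc d) = 0# , (_^ d) , monic-^ d , λ z → sym (R.+-identityˡ _)

  monic-+ : ∀ {d h} s {e} → e ℕ.< d → Monic d h → Monic d (λ z → (s * (z ^ e)) + h z)
  monic-+ {suc d} {h} s {zero} _ (c , k , monic , eq) = s + c , k , monic , λ z → begin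
    (s * 1#) + h z           ≡⟨ cong₂ _+_ (R.*-identityʳ s) (eq z) ⟩
    s + (c + (z * k z))      ≡⟨ R.+-assoc s c _ ⟨
    (s + c) + (z * k z)      ∎
    where open ≡-Reasoning
  monic-+ {suc d} {h} s {suc e} (s<s e<d) (c , k , monic , eq) = c , _ , monic-+ s e<d monic , λ z → begin
    (s * (z * (z ^ e))) + h z                  ≡⟨ cong ((s * (z * (z ^ e))) +_) (eq z) ⟩
    (s * (z * (z ^ e))) + (c + (z * k z))      ≡⟨ rearrange s z (z ^ e) c (k z) ⟩
    c + (z * ((s * (z ^ e)) + k z))            ∎
    where
    open ≡-Reasoning
    rearrange : ∀ s z y c k → (s * (z * y)) + (c + (z * k)) ≡ c + (z * ((s * y) + k))
    rearrange = solve 5 (λ s z y c k → (s :* (z :* y)) :+ (c :+ (z :* k)) := c :+ (z :* ((s :* y) :+ k))) refl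

  -- Synthetic division: for h = c + z k, h(z) - h(r) = (z - r) k(r) + z (k(z) - k(r)), and the last
  -- difference is divisible by z - r by induction.
  monic-divide : ∀ {d h} r → Monic (suc d) h → ∃ λ k → Monic d k × (∀ z → h z - h r ≡ (z - r) * k z)
  monic-divide {zero} {h} r (c , k , k≡1 , eq) = k , k≡1 , λ z → begin
    h z - h r                          ≡⟨ cong₂ _-_ (eq z) (eq r) ⟩
    (c + (z * k z)) - (c + (r * k r))  ≡⟨ cong (λ y → (c + (z * k z)) - (c + (r * y))) (trans (k≡1 r) (sym (k≡1 z))) ⟩
    (c + (z * k z)) - (c + (r * k z))  ≡⟨ rearrange c z r (k z) ⟩
    (z - r) * k z                      ∎
    where
    open ≡-Reasoning
    rearrange : ∀ c z r k → (c + (z * k)) - (c + (r * k)) ≡ (z - r) * k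
    rearrange = solve 4 (λ c z r k → (c :+ z :* k) :- (c :+ r :* k) := (z :- r) :* k) refl
  monic-divide {suc d} {h} r (c , k , monic , eq) with l , monic′ , eq′ ← monic-divide r monic =
    (λ z → k r + (z * l z)) , (k r , l , monic′ , λ z → refl) , λ z → begin
    h z - h r                                          ≡⟨ cong₂ _-_ (eq z) (eq r) ⟩
    (c + (z * k z)) - (c + (r * k r))                  ≡⟨ rearrange c z r (k z) (k r) ⟩
    ((z - r) * k r) + (z * (k z - k r))                ≡⟨ cong (λ y → ((z - r) * k r) + (z * y)) (eq′ z) ⟩
    ((z - r) * k r) + (z * ((z - r) * l z))            ≡⟨ rearrange′ z r (k r) (l z) ⟩
    (z - r) * (k r + (z * l z))                        ∎
    where
    open ≡-Reasoning
    rearrange : ∀ c z r k m → (c + (z * k)) - (c + (r * m)) ≡ ((z - r) * m) + (z * (k - m))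
    rearrange = solve 5 (λ c z r k m → (c :+ z :* k) :- (c :+ r :* m) := (z :- r) :* m :+ z :* (k :- m)) refl
    rearrange′ : ∀ z r m l → ((z - r) * m) + (z * ((z - r) * l)) ≡ (z - r) * (m + (z * l))
    rearrange′ = solve 4 (λ z r m l → (z :- r) :* m :+ z :* ((z :- r) :* l) := (z :- r) :* (m :+ z :* l)) refl

  -- After dividing by z - r, any other root is a root of the quotient because there are no zero
  -- divisors.
  monic-roots : ∀ {d h xs} → Monic d h → Unique xs → All (λ x → h x ≡ 0#) xs → length xs ℕ.≤ d
  monic-roots                     monic u []       = z≤n
  monic-roots {zero}              h≡1   u (hr≡0 ∷ _) = contradiction (trans (sym (h≡1 _)) hr≡0) 1≢0
  monic-roots {suc d} {h} {r ∷ xs} monic (r∉xs ∷ u) (hr≡0 ∷ roots) with k , monic′ , eq ← monic-divide r monic =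
    s≤s (monic-roots monic′ u (All.zipWith root (r∉xs , roots)))
    where
    open Algebra.Properties.Group R.+-group using (x∙y⁻¹≈ε⇒x≈y; x≈y⇒x∙y⁻¹≈ε)
    root : ∀ {x} → r ≢ x × h x ≡ 0# → k x ≡ 0#
    root {x} (r≢x , hx≡0) with k x ≟ 0#
    ... | yes kx≡0 = kx≡0
    ... | no  kx≢0 = contradiction (trans (sym (eq x)) (x≈y⇒x∙y⁻¹≈ε (trans hx≡0 (sym hr≡0))))
                       (*-nonZero (λ x-r≡0 → r≢x (sym (x∙y⁻¹≈ε⇒x≈y _ _ x-r≡0))) kx≢0)

  -- Frobenius and the trace in characteristic p.

  module Characteristic {p : ℕ} (pp : Prime p) (char : p ∙ 1# ≡ 0#) where

    private instance
      p≢0 : NonZero p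
      p≢0 = prime⇒nonZero pp

    p∙≡0 : ∀ a → p ∙ a ≡ 0#
    p∙≡0 a = begin
      p ∙ a           ≡⟨ cong (p ∙_) (R.*-identityˡ a) ⟨
      p ∙ (1# * a)    ≡⟨ ×-assoc-* p 1# a ⟨
      (p ∙ 1#) * a    ≡⟨ cong (_* a) char ⟩
      0# * a          ≡⟨ R.zeroˡ a ⟩
      0#              ∎
      where open ≡-Reasoning

    ∣⇒∙≡0 : ∀ {m} a → p ∣ m → m ∙ a ≡ 0#
    ∣⇒∙≡0 a (divides q refl) = trans (cong (_∙ a) (ℕₚ.*-comm q p)) (trans (sym (×-assocˡ a p q)) (p∙≡0 (q ∙ a)))

    -- Only the two ends of the binomial expansion survive: the inner coefficients are divisible by
    -- p.
    frobenius-+ : ∀ x y → (x + y) ^ p ≡ (x ^ p) + (y ^ p)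
    frobenius-+ x y = go p refl
      where
      open Algebra.Properties.CommutativeSemiring.Binomial R.commutativeSemiring using (theorem; binomialTerm)
      open Algebra.Properties.Monoid.Sum R.+-monoid using (sum; sum-init-last; sum-cong-≗; sum-replicate-zero)
      open ≡-Reasoning
      -- The exponent is generalised so that it can be exposed as a successor, which splits both end
      -- terms off the sum.
      go : ∀ q → q ≡ p → (x + y) ^ q ≡ (x ^ q) + (y ^ q)
      go zero    q≡p = contradiction (sym q≡p) (ℕ.≢-nonZero⁻¹ p)
      go (suc q) refl = begin
        (x + y) ^ suc q                                                    ≡⟨ theorem (suc q) x y ⟩
        term zero + sum (λ j → term (suc j))
          ≡⟨ cong (term zero +_) (sum-init-last (λ j → term (suc j))) ⟩
        term zero + (sum (λ j → term (suc (inject₁ j))) + term (fromℕ (suc q)))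
          ≡⟨ cong (λ s → term zero + (s + term (fromℕ (suc q)))) (trans (sum-cong-≗ middle) (sum-replicate-zero q)) ⟩
        term zero + (0# + term (fromℕ (suc q)))
          ≡⟨ cong₂ (λ a b → a + (0# + b)) bottom top ⟩
        (y ^ suc q) + (0# + (x ^ suc q))
          ≡⟨ cong ((y ^ suc q) +_) (R.+-identityˡ _) ⟩
        (y ^ suc q) + (x ^ suc q)                                          ≡⟨ R.+-comm _ _ ⟩
        (x ^ suc q) + (y ^ suc q)                                          ∎
        where
        term : Fin (suc (suc q)) → A
        term = binomialTerm x y (suc q)
        middle : ∀ j → term (suc (inject₁ j)) ≡ 0#
        middle j = ∣⇒∙≡0 _ (prime∣C pp z<s (s<s (subst (ℕ._< q) (sym (Finₚ.toℕ-inject₁ j)) (Finₚ.toℕ<n j))))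
        bottom : term zero ≡ y ^ suc q
        bottom = trans (R.+-identityʳ _) (R.*-identityˡ _)
        top : term (fromℕ (suc q)) ≡ x ^ suc q
        top = begin
          (suc q C suc (toℕ (fromℕ q))) ∙ ((x ^ suc (toℕ (fromℕ q))) * (y ^ (q ℕ.∸ toℕ (fromℕ q))))
            ≡⟨ cong (λ i → (suc q C suc i) ∙ ((x ^ suc i) * (y ^ (q ℕ.∸ i)))) (Finₚ.toℕ-fromℕ q) ⟩
          (suc q C suc q) ∙ ((x ^ suc q) * (y ^ (q ℕ.∸ q)))
            ≡⟨ cong₂ (λ c i → c ∙ ((x ^ suc q) * (y ^ i))) (nCn≡1 (suc q)) (ℕₚ.n∸n≡0 q) ⟩
          ((x ^ suc q) * 1#) + 0#
            ≡⟨ trans (R.+-identityʳ _) (R.*-identityʳ _) ⟩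
          x ^ suc q ∎

    0^p : 0# ^ p ≡ 0#
    0^p = trans (cong (0# ^_) (sym (ℕₚ.suc-pred p))) (R.zeroˡ _)

    1^ : ∀ k → 1# ^ k ≡ 1#
    1^ zero    = refl
    1^ (suc k) = trans (R.*-identityˡ _) (1^ k)

    -- Frobenius is additive and fixes 1, hence fixes every multiple of 1.
    prime-subfield-fixed : ∀ m → (m ∙ 1#) ^ p ≡ m ∙ 1#
    prime-subfield-fixed zero    = 0^p
    prime-subfield-fixed (suc m) = trans (frobenius-+ 1# (m ∙ 1#)) (cong₂ _+_ (1^ p) (prime-subfield-fixed m))

    -- The p listed fixed points are already all roots that X^p - X can have; a further one would
    -- exceed its degree.
    fixed⇒∈ : ∀ {xs} → Unique xs → All (λ x → x ^ p ≡ x) xs → length xs ≡ p → ∀ t → t ^ p ≡ t → t ∈ xs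
    fixed⇒∈ {xs} u fixed len t t^p≡t with Any.any? (t ≟_) xs
    ... | yes t∈xs = t∈xs
    ... | no  t∉xs =
      contradiction (subst (λ l → suc l ℕ.≤ p) len
        (monic-roots X^p-X (Allₚ.¬Any⇒All¬ xs t∉xs ∷ u) (root t^p≡t ∷ All.map root fixed))) (ℕₚ.<-irrefl refl)
      where
      X^p-X : Monic p (λ z → ((- 1#) * (z ^ 1)) + (z ^ p))
      X^p-X = monic-+ (- 1#) (ℕ.nonTrivial⇒n>1 p {{prime⇒nonTrivial pp}}) (monic-^ p)
      root : ∀ {z} → z ^ p ≡ z → ((- 1#) * (z ^ 1)) + (z ^ p) ≡ 0#
      root {z} eq = begin
        ((- 1#) * (z * 1#)) + (z ^ p)    ≡⟨ cong₂ (λ a b → ((- 1#) * a) + b) (R.*-identityʳ z) eq ⟩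
        ((- 1#) * z) + z                 ≡⟨ cong (_+ z) (-1*x≈-x z) ⟩
        (- z) + z                        ≡⟨ R.-‿inverseˡ z ⟩
        0#                               ∎
        where
        open ≡-Reasoning
        open Algebra.Properties.Ring R.ring using (-1*x≈-x)

    frobenius^-+ : ∀ i x y → (x + y) ^ (p ℕ.^ i) ≡ (x ^ (p ℕ.^ i)) + (y ^ (p ℕ.^ i))
    frobenius^-+ zero    x y = trans (R.*-identityʳ _) (sym (cong₂ _+_ (R.*-identityʳ x) (R.*-identityʳ y)))
    frobenius^-+ (suc i) x y = begin
      (x + y) ^ (p ℕ.* p ℕ.^ i)                                   ≡⟨ ^-assocʳ (x + y) p (p ℕ.^ i) ⟨
      ((x + y) ^ p) ^ (p ℕ.^ i)                                   ≡⟨ cong (_^ (p ℕ.^ i)) (frobenius-+ x y) ⟩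
      ((x ^ p) + (y ^ p)) ^ (p ℕ.^ i)                             ≡⟨ frobenius^-+ i (x ^ p) (y ^ p) ⟩
      ((x ^ p) ^ (p ℕ.^ i)) + ((y ^ p) ^ (p ℕ.^ i))               ≡⟨ cong₂ _+_ (^-assocʳ x p _) (^-assocʳ y p _) ⟩
      (x ^ (p ℕ.* p ℕ.^ i)) + (y ^ (p ℕ.* p ℕ.^ i))               ∎
      where open ≡-Reasoning

    opaque
      trace : ℕ → A → A
      trace n z = foldr _+_ 0# (L.map (λ i → z ^ (p ℕ.^ toℕ i)) (allFin n))

      trace-def : ∀ n z → trace n z ≡ foldr _+_ 0# (L.map (λ i → z ^ (p ℕ.^ toℕ i)) (allFin n))
      trace-def n z = refl

    private
      -- With summands indexed by all naturals, either end can be split off and a shift is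
      -- composition with `suc`, as the cyclic shift in `trace-fixed` requires.
      ∑< : ℕ → (ℕ → A) → A
      ∑< zero    h = 0#
      ∑< (suc n) h = h 0 + ∑< n (h ∘ suc)

      ∑<-last : ∀ n h → ∑< (suc n) h ≡ ∑< n h + h n
      ∑<-last zero    h = R.+-comm (h 0) 0#
      ∑<-last (suc n) h = trans (cong (h 0 +_) (∑<-last n (h ∘ suc))) (sym (R.+-assoc _ _ _))

      ∑<-+ : ∀ n h k → ∑< n (λ i → h i + k i) ≡ ∑< n h + ∑< n k
      ∑<-+ zero    h k = sym (R.+-identityˡ 0#)
      ∑<-+ (suc n) h k = trans (cong ((h 0 + k 0) +_) (∑<-+ n (h ∘ suc) (k ∘ suc)))
        (solve 4 (λ a b c d → (a :+ b) :+ (c :+ d) := (a :+ c) :+ (b :+ d)) refl (h 0) (k 0) _ _)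

      ∑<-cong : ∀ n {h k} → (∀ i → h i ≡ k i) → ∑< n h ≡ ∑< n k
      ∑<-cong zero    h≗k = refl
      ∑<-cong (suc n) h≗k = cong₂ _+_ (h≗k 0) (∑<-cong n (h≗k ∘ suc))

      ∑<-frobenius : ∀ n h → ∑< n h ^ p ≡ ∑< n (λ i → h i ^ p)
      ∑<-frobenius zero    h = 0^p
      ∑<-frobenius (suc n) h = trans (frobenius-+ _ _) (cong ((h 0 ^ p) +_) (∑<-frobenius n (h ∘ suc)))

      conjugate : A → ℕ → A
      conjugate z i = z ^ (p ℕ.^ i)

      foldr-tabulate : ∀ n (h : ℕ → A) → foldr _+_ 0# (L.tabulate {n = n} (h ∘ toℕ)) ≡ ∑< n h
      foldr-tabulate zero    h = refl
      foldr-tabulate (suc n) h = cong (h 0 +_) (foldr-tabulate n (h ∘ suc))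

      trace-∑< : ∀ n z → trace n z ≡ ∑< n (conjugate z)
      trace-∑< n z =
        trans (trace-def n z)
          (trans (cong (foldr _+_ 0#) (Lₚ.map-tabulate {n = n} id _)) (foldr-tabulate n (conjugate z)))

    trace-+ : ∀ n x y → trace n (x + y) ≡ trace n x + trace n y
    trace-+ n x y = begin
      trace n (x + y)                               ≡⟨ trace-∑< n (x + y) ⟩
      ∑< n (conjugate (x + y))                      ≡⟨ ∑<-cong n (λ i → frobenius^-+ i x y) ⟩
      ∑< n (λ i → conjugate x i + conjugate y i)    ≡⟨ ∑<-+ n _ _ ⟩
      ∑< n (conjugate x) + ∑< n (conjugate y)       ≡⟨ cong₂ _+_ (trace-∑< n x) (trace-∑< n y) ⟨
      trace n x + trace n y                         ∎
      where open ≡-Reasoning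

    module _ {m : ℕ} (size : length elements ≡ p ℕ.^ suc m) where

      private n = suc m

      -- Frobenius permutes the conjugates cyclically: each moves to the next, and the last becomes
      -- z^(p^n) = z by `fermat`.
      trace-fixed : ∀ z → trace n z ^ p ≡ trace n z
      trace-fixed z = begin
        trace n z ^ p                              ≡⟨ cong (_^ p) (trace-∑< n z) ⟩
        ∑< n h ^ p                                 ≡⟨ ∑<-frobenius n h ⟩
        ∑< n (λ i → h i ^ p)
          ≡⟨ ∑<-cong n (λ i → trans (^-assocʳ z (p ℕ.^ i) p) (cong (z ^_) (ℕₚ.*-comm (p ℕ.^ i) p))) ⟩
        ∑< n (h ∘ suc)                             ≡⟨ ∑<-last m (h ∘ suc) ⟩
        ∑< m (h ∘ suc) + h n                       ≡⟨ R.+-comm _ _ ⟩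
        h n + ∑< m (h ∘ suc)
          ≡⟨ cong (_+ ∑< m (h ∘ suc))
            (trans (cong (z ^_) (sym size)) (trans (fermat z) (sym (R.*-identityʳ z)))) ⟩
        ∑< n h                                     ≡⟨ trace-∑< n z ⟨
        trace n z                                  ∎
        where
        open ≡-Reasoning
        h = conjugate z

      -- The top term is z^(p^m), and the other conjugates are monomials of smaller exponent.
      trace-monic : Monic (p ℕ.^ m) (trace n)
      trace-monic =
        monic-cong (λ z → sym (trans (trace-∑< n z) (∑<-last m (conjugate z))))
          (go m ℕₚ.≤-refl (monic-^ (p ℕ.^ m)))
        where
        monic-cong : ∀ {d h k} → (∀ z → k z ≡ h z) → Monic d k → Monic d h
        monic-cong {zero}  eq k≡1 = λ z → trans (sym (eq z)) (k≡1 z)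
        monic-cong {suc d} eq (c , l , monic , eq′) = c , l , monic , λ z → trans (sym (eq z)) (eq′ z)
        go : ∀ k {h} → k ℕ.≤ m → Monic (p ℕ.^ m) h → Monic (p ℕ.^ m) (λ z → ∑< k (conjugate z) + h z)
        go zero    _   monic = monic-cong (λ z → sym (R.+-identityˡ _)) monic
        go (suc k) {h} k<m monic = monic-cong (λ z → begin
            ∑< k (conjugate z) + ((1# * conjugate z k) + h z)
              ≡⟨ cong (λ c → ∑< k (conjugate z) + (c + h z)) (R.*-identityˡ _) ⟩
            ∑< k (conjugate z) + (conjugate z k + h z)           ≡⟨ R.+-assoc _ _ _ ⟨
            (∑< k (conjugate z) + conjugate z k) + h z           ≡⟨ cong (_+ h z) (∑<-last k (conjugate z)) ⟨
            ∑< (suc k) (conjugate z) + h z                       ∎)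
          (go k (ℕₚ.<⇒≤ k<m) (monic-+ 1# (ℕₚ.^-monoʳ-< p (ℕ.nonTrivial⇒n>1 p {{prime⇒nonTrivial pp}}) k<m) monic))
          where open ≡-Reasoning

      -- A polynomial of degree p^m cannot vanish at all p^(m+1) elements.
      trace-nonZero : ∃ λ z → trace n z ≢ 0#
      trace-nonZero with All.all? (λ z → trace n z ≟ 0#) elements
      ... | no  some = Any.satisfied (Allₚ.¬All⇒Any¬ (λ z → trace n z ≟ 0#) elements some)
      ... | yes all  = contradiction (subst (ℕ._≤ p ℕ.^ m) size (monic-roots trace-monic unique all))
        (ℕₚ.<⇒≱ (ℕₚ.^-monoʳ-< p (ℕ.nonTrivial⇒n>1 p {{prime⇒nonTrivial pp}}) (ℕₚ.n<1+n m)))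

      -- The constants `ι a` are p distinct fixed points of Frobenius, hence all of them, and trace
      -- values are fixed. So the trace is a constant, and reading off one coordinate of it loses
      -- nothing.
      trace-nonZero-in-subfield : (ι : Fin p → A) → (∀ {a b} → ι a ≡ ι b → a ≡ b) → (∀ a → ∃ λ k → k ∙ 1# ≡ ι a) →
                                  ∃ λ z → ∃ λ a → trace n z ≡ ι a × ι a ≢ 0#
      trace-nonZero-in-subfield ι ι-injective ι-multiple with z , trace≢0 ← trace-nonZero =
        let a , _ , trace≡ιa = ∈-map⁻ ι (trace∈ z) in z , a , trace≡ιa , λ ιa≡0 → trace≢0 (trans trace≡ιa ιa≡0)
        where
        fixed : ∀ a → ι a ^ p ≡ ι a
        fixed a with k , k∙1≡ιa ← ι-multiple a = subst (λ x → x ^ p ≡ x) k∙1≡ιa (prime-subfield-fixed k)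
        length-constants : length (L.map ι (allFin p)) ≡ p
        length-constants = trans (Lₚ.length-map ι (allFin p)) (Lₚ.length-tabulate {n = p} id)
        trace∈ : ∀ z → trace n z ∈ L.map ι (allFin p)
        trace∈ z = fixed⇒∈ (Uniqueₚ.map⁺ ι-injective (Uniqueₚ.allFin⁺ p)) (Allₚ.map⁺ (Allₚ.tabulate⁺ fixed))
          length-constants (trace n z) (trace-fixed z)

      module Pairing {F : Set} (_⊞_ : Op₂ F) (0F : F)
        (coefficient : A → F) (coefficient-+ : ∀ u v → coefficient (u + v) ≡ coefficient u ⊞ coefficient v)
        (ι : Fin p → A) (ι-injective : ∀ {a b} → ι a ≡ ι b → a ≡ b) (ι-multiple : ∀ a → ∃ λ k → k ∙ 1# ≡ ι a)
        (coefficient-ι : ∀ a → coefficient (ι a) ≡ 0F → ι a ≡ 0#)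
        (τ : A → F) (τ-def : ∀ z → τ z ≡ coefficient (trace n z))
        where

        τ-+ : ∀ x y → τ (x + y) ≡ τ x ⊞ τ y
        τ-+ x y = begin
          τ (x + y)                                            ≡⟨ τ-def (x + y) ⟩
          coefficient (trace n (x + y))                        ≡⟨ cong coefficient (trace-+ n x y) ⟩
          coefficient (trace n x + trace n y)                  ≡⟨ coefficient-+ _ _ ⟩
          coefficient (trace n x) ⊞ coefficient (trace n y)    ≡⟨ cong₂ _⊞_ (τ-def x) (τ-def y) ⟨
          τ x ⊞ τ y                                            ∎
          where open ≡-Reasoning

        τ-nonZero : ∃ λ z → τ z ≢ 0F
        τ-nonZero with z , a , trace≡a , a≢0 ← trace-nonZero-in-subfield ι ι-injective ι-multiple =
          z , λ τ≡0 → a≢0 (coefficient-ι a (trans (cong coefficient (sym trace≡a)) (trans (sym (τ-def z)) τ≡0)))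

        pairing-+ˡ : ∀ x x′ y → τ ((x + x′) * y) ≡ τ (x * y) ⊞ τ (x′ * y)
        pairing-+ˡ x x′ y = trans (cong τ (R.distribʳ y x x′)) (τ-+ (x * y) (x′ * y))

        pairing-+ʳ : ∀ x y y′ → τ (x * (y + y′)) ≡ τ (x * y) ⊞ τ (x * y′)
        pairing-+ʳ x y y′ = trans (cong τ (R.distribˡ x y y′)) (τ-+ (x * y) (x * y′))

        -- With τ z nonzero, the choice y = x⁻¹ z turns the product x y into z.
        pairing-nondegenerate : ∀ x → x ≢ 0# → ∃ λ y → τ (x * y) ≢ 0F
        pairing-nondegenerate x x≢0 with x⁻¹ , xx⁻¹≡1 ← inverse x x≢0 with z , τz≢0 ← τ-nonZero =
          x⁻¹ * z , λ eq → τz≢0 (trans (cong τ (sym x[x⁻¹z]≡z)) eq)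
          where
          x[x⁻¹z]≡z : x * (x⁻¹ * z) ≡ z
          x[x⁻¹z]≡z = trans (sym (R.*-assoc x x⁻¹ z)) (trans (cong (_* z) xx⁻¹≡1) (R.*-identityˡ z))

-- Enumeration of F_p^n.

module _ (p : ℕ) {{_ : NonZero p}} where

  private
    concatMap≡cartesianProductWith : ∀ {n} (xs : List (Fp p)) (vs : List (V p n)) →
      L.concatMap (λ a → L.map (a ∷_) vs) xs ≡ cartesianProductWith V._∷_ xs vs
    concatMap≡cartesianProductWith []       vs = refl
    concatMap≡cartesianProductWith (x ∷ xs) vs = cong (L.map (x ∷_) vs L.++_) (concatMap≡cartesianProductWith xs vs)

    allV-suc : ∀ n → allV p (suc n) ≡ cartesianProductWith V._∷_ (allFin p) (allV p n)
    allV-suc n = concatMap≡cartesianProductWith (allFin p) (allV p n)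

  private
    allV-unique : ∀ n → Unique (allV p n)
    allV-unique zero    = [] ∷ []
    allV-unique (suc n) = subst Unique (sym (allV-suc n))
      (Uniqueₚ.cartesianProductWith⁺ V._∷_ Vₚ.∷-injective (Uniqueₚ.allFin⁺ p) (allV-unique n))

    ∈-allV : ∀ {n} (v : V p n) → v ∈ allV p n
    ∈-allV []      = here refl
    ∈-allV (a ∷ v) = subst ((a ∷ v) ∈_) (sym (allV-suc _)) (∈-cartesianProductWith⁺ V._∷_ (∈-allFin a) (∈-allV v))

  enumerateV : ∀ n → Enumeration (V p n)
  enumerateV n = record { elements = allV p n ; unique = allV-unique n ; complete = ∈-allV }

  length-allV : ∀ n → length (allV p n) ≡ p ℕ.^ n
  length-allV zero    = refl
  length-allV (suc n) = trans (cong length (allV-suc n))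
    (trans (length-cartesianProductWith (allFin p) (allV p n))
      (cong₂ ℕ._*_ (Lₚ.length-tabulate {n = p} id) (length-allV n)))
    where
    length-cartesianProductWith : ∀ (xs : List (Fp p)) (vs : List (V p n)) →
      length (cartesianProductWith V._∷_ xs vs) ≡ length xs ℕ.* length vs
    length-cartesianProductWith []       vs = refl
    length-cartesianProductWith (x ∷ xs) vs = trans (Lₚ.length-++ (L.map (x ∷_) vs))
      (cong₂ ℕ._+_ (Lₚ.length-map (x ∷_) vs) (length-cartesianProductWith xs vs))

  _≟ⱽ_ : ∀ {n} → DecidableEquality (V p n)
  _≟ⱽ_ = Vₚ.≡-dec Finₚ._≟_

-- The trace form of the field F_p[X]/(g).

module TracePairing (p : ℕ) {{_ : NonZero p}} (pp : Prime p) {m : ℕ} (g : V p (suc m)) (isField : IsField p g) where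

  open PrimeField p
  open VectorSpace p
  open QuotientRing p g
  private
    n = suc m
    module R = CommutativeRing (RingSolver.ring ⊛-isCommutativeRing)
    1ⱽ≢0ⱽ : 1ⱽ ≢ 0ⱽ
    1ⱽ≢0ⱽ eq = 1ᶠ≢0ᶠ pp (cong V.head eq)

  open FiniteField ⊛-isCommutativeRing 1ⱽ≢0ⱽ isField (_≟ⱽ_ p) (enumerateV p n)
  open Algebra.Properties.Semiring.Exp R.semiring using (_^_)
  open Algebra.Properties.Semiring.Mult R.semiring using () renaming (_×_ to _∙_)

  private
    coefficient : V p n → Fp p
    coefficient = coeff0 p

    coefficient-⊹ : ∀ u v → coefficient (u ⊹ v) ≡ coefficient u +ᶠ coefficient v
    coefficient-⊹ (a ∷ u) (b ∷ v) = refl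

    coefficient-• : ∀ a → coefficient (a • 1ⱽ) ≡ a
    coefficient-• a = *ᶠ-identityʳ a

    ∙1ⱽ : ∀ k → k ∙ 1ⱽ ≡ (k ×ᶠ 1ᶠ) • 1ⱽ
    ∙1ⱽ zero    = sym (•-zeroˡ 1ⱽ)
    ∙1ⱽ (suc k) = trans (cong₂ _⊹_ (sym (•-identityˡ 1ⱽ)) (∙1ⱽ k)) (sym (•-distribʳ 1ⱽ 1ᶠ (k ×ᶠ 1ᶠ)))

    characteristicⱽ : p ∙ 1ⱽ ≡ 0ⱽ
    characteristicⱽ = trans (∙1ⱽ p) (trans (cong (_• 1ⱽ) (characteristic 1ᶠ)) (•-zeroˡ 1ⱽ))

  open Characteristic pp characteristicⱽ

  private
    fpow≡^ : ∀ z k → fpow p g z k ≡ z ^ k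
    fpow≡^ z zero    = refl
    fpow≡^ z (suc k) = cong (z ⊛_) (fpow≡^ z k)

    Tr≡trace : ∀ z → Tr p g z ≡ coefficient (trace n z)
    Tr≡trace z =
      trans (cong (λ xs → coefficient (foldr _⊹_ 0ⱽ xs))
        (Lₚ.map-cong (λ i → fpow≡^ z (p ℕ.^ toℕ i)) (allFin n))) (cong coefficient (sym (trace-def n z)))

    constant-multiple : ∀ a → ∃ λ k → k ∙ 1ⱽ ≡ a • 1ⱽ
    constant-multiple a = map₂ (λ {k} k×1≡a → trans (∙1ⱽ k) (cong (_• 1ⱽ) k×1≡a)) (multiples pp (1ᶠ≢0ᶠ pp) a)

    constant-injective : ∀ {a b} → a • 1ⱽ ≡ b • 1ⱽ → a ≡ b
    constant-injective {a} {b} eq = trans (sym (coefficient-• a)) (trans (cong coefficient eq) (coefficient-• b))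

    constant-0 : ∀ a → coefficient (a • 1ⱽ) ≡ 0ᶠ → a • 1ⱽ ≡ 0ⱽ
    constant-0 a eq = trans (cong (_• 1ⱽ) (trans (sym (coefficient-• a)) eq)) (•-zeroˡ 1ⱽ)

  open Pairing {m} (length-allV p n) _+ᶠ_ 0ᶠ coefficient coefficient-⊹ (_• 1ⱽ) constant-injective constant-multiple
    constant-0 (Tr p g) Tr≡trace public
    using (pairing-+ˡ; pairing-+ʳ; pairing-nondegenerate)

-- Finite differences and degree.

module Differences
  {A : Set} {_⊹_ : Op₂ A} {0A : A} {negA : Op₁ A} (isAG : IsAbelianGroup _≡_ _⊹_ 0A negA)
  {F : Set} {_+_ _*_ : Op₂ F} { -_ : Op₁ F} {0# 1# : F} (isCR : IsCommutativeRing _≡_ _+_ _*_ -_ 0# 1#)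
  {_∸_ : Op₂ F} (∸-def : ∀ a b → a ∸ b ≡ a + (- b)) where

  open RingSolver isCR
  private
    module R = CommutativeRing ring
    module G = IsAbelianGroup isAG

  Δ : A → (A → F) → A → F
  Δ a h x = h (x ⊹ a) ∸ h x

  -- Puts the iterated difference into the form of `D2`.
  Δ-swap : ∀ a b h x → Δ b (Δ a h) x ≡ ((h ((x ⊹ a) ⊹ b) ∸ h (x ⊹ a)) ∸ h (x ⊹ b)) + h x
  Δ-swap a b h x rewrite G.assoc x b a | G.comm b a | sym (G.assoc x a b) = identity _ _ _ _
    where
    identity : ∀ s t u v → (s ∸ u) ∸ (t ∸ v) ≡ ((s ∸ t) ∸ u) + v
    identity s t u v rewrite ∸-def (s ∸ u) (t ∸ v) | ∸-def ((s ∸ t)) u | ∸-def s u | ∸-def t v | ∸-def s t =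
      solve 4 (λ s t u v → (s :- u) :- (t :- v) := ((s :- t) :- u) :+ v) refl s t u v

  ∸≡⇒≡+ : ∀ {s t u} → s ∸ t ≡ u → s ≡ t + u
  ∸≡⇒≡+ {s} {t} refl rewrite ∸-def s t = solve 2 (λ s t → s := t :+ (s :- t)) refl s t

  ∸-self : ∀ s → s ∸ s ≡ 0#
  ∸-self s = trans (∸-def s s) (R.-‿inverseʳ s)

  ∸≡0⇒≡ : ∀ {s t} → s ∸ t ≡ 0# → s ≡ t
  ∸≡0⇒≡ eq = trans (∸≡⇒≡+ eq) (R.+-identityʳ _)

  -- Degree in the sense of Fréchet: all k-fold differences vanish. The bound is strict, so degree
  -- at most d corresponds to `suc d`, and cubic functions satisfy it with 4.
  DegreeBelow : ℕ → (A → F) → Set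
  DegreeBelow zero    h = ∀ x → h x ≡ 0#
  DegreeBelow (suc k) h = ∀ a → DegreeBelow k (Δ a h)

  degreeBelow-cong : ∀ k {h l : A → F} → (∀ x → h x ≡ l x) → DegreeBelow k h → DegreeBelow k l
  degreeBelow-cong zero    h≗l h<k x = trans (sym (h≗l x)) (h<k x)
  degreeBelow-cong (suc k) h≗l h<k a = degreeBelow-cong k (λ x → cong₂ _∸_ (h≗l (x ⊹ a)) (h≗l x)) (h<k a)

  degreeBelow-suc : ∀ k h → DegreeBelow k h → DegreeBelow (suc k) h
  degreeBelow-suc zero    h h≡0 a x = trans (cong₂ _∸_ (h≡0 (x ⊹ a)) (h≡0 x)) (∸-self 0#)
  degreeBelow-suc (suc k) h h<k a   = degreeBelow-suc k (Δ a h) (h<k a)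

  degreeBelow-0 : ∀ k → DegreeBelow k (λ _ → 0#)
  degreeBelow-0 zero    x = refl
  degreeBelow-0 (suc k) = degreeBelow-suc k _ (degreeBelow-0 k)

  degreeBelow-≤ : ∀ {k l} h → k ℕ.≤ l → DegreeBelow k h → DegreeBelow l h
  degreeBelow-≤ h k≤l = go (ℕₚ.≤⇒≤′ k≤l)
    where
    go : ∀ {k l} → k ℕ.≤′ l → DegreeBelow k h → DegreeBelow l h
    go (ℕ.≤′-reflexive refl) h<k = h<k
    go (ℕ.≤′-step k≤l)       h<k = degreeBelow-suc _ h (go k≤l h<k)

  degreeBelow-+ : ∀ k h l → DegreeBelow k h → DegreeBelow k l → DegreeBelow k (λ x → h x + l x)
  degreeBelow-+ zero    h l h<k l<k x = trans (cong₂ _+_ (h<k x) (l<k x)) (R.+-identityˡ 0#)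
  degreeBelow-+ (suc k) h l h<k l<k a = degreeBelow-cong k (λ x → identity (h (x ⊹ a)) (h x) (l (x ⊹ a)) (l x))
    (degreeBelow-+ k (Δ a h) (Δ a l) (h<k a) (l<k a))
    where
    identity : ∀ s t u v → (s ∸ t) + (u ∸ v) ≡ (s + u) ∸ (t + v)
    identity s t u v rewrite ∸-def s t | ∸-def u v | ∸-def (s + u) (t + v) =
      solve 4 (λ s t u v → (s :- t) :+ (u :- v) := (s :+ u) :- (t :+ v)) refl s t u v

  degreeBelow-scale : ∀ k c h → DegreeBelow k h → DegreeBelow k (λ x → c * h x)
  degreeBelow-scale zero    c h h<k x = trans (cong (c *_) (h<k x)) (R.zeroʳ c)
  degreeBelow-scale (suc k) c h h<k a = degreeBelow-cong k (λ x → identity (h (x ⊹ a)) (h x))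
    (degreeBelow-scale k c (Δ a h) (h<k a))
    where
    identity : ∀ s t → c * (s ∸ t) ≡ (c * s) ∸ (c * t)
    identity s t rewrite ∸-def s t | ∸-def (c * s) (c * t) =
      solve 3 (λ c s t → c :* (s :- t) := c :* s :- c :* t) refl c s t

  degreeBelow-shift : ∀ k a h → DegreeBelow k h → DegreeBelow k (λ x → h (x ⊹ a))
  degreeBelow-shift zero    a h h<k x = h<k (x ⊹ a)
  degreeBelow-shift (suc k) a h h<k b = degreeBelow-cong k
    (λ x → cong (λ y → h y ∸ h (x ⊹ a)) (trans (G.assoc x a b) (trans (cong (x ⊹_) (G.comm a b)) (sym (G.assoc x b a)))))
    (degreeBelow-shift k a (Δ b h) (h<k b))

  -- By the product rule, the difference of u h in direction a is u(x) Δ_a h(x) + u(a) h(x + a). The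
  -- first term is covered by induction; in the second u(a) is a scalar.
  degreeBelow-*ˡ : ∀ k (u h : A → F) → (∀ x a → u (x ⊹ a) ≡ u x + u a) → DegreeBelow k h →
      DegreeBelow (suc k) (λ x → u x * h x)
  degreeBelow-*ˡ zero u h additive h≡0 a x =
    trans (cong₂ _∸_ (trans (cong (u (x ⊹ a) *_) (h≡0 (x ⊹ a))) (R.zeroʳ _)) (trans (cong (u x *_) (h≡0 x)) (R.zeroʳ _))) (∸-self 0#)
  degreeBelow-*ˡ (suc k) u h additive h<k a = degreeBelow-cong (suc k) product-rule
    (degreeBelow-+ (suc k) _ _ (degreeBelow-*ˡ k u (Δ a h) additive (h<k a))
      (degreeBelow-scale (suc k) (u a) _ (degreeBelow-shift (suc k) a h h<k)))
    where
    identity : ∀ u v s t → (u * (s ∸ t)) + (v * s) ≡ ((u + v) * s) ∸ (u * t)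
    identity u v s t rewrite ∸-def s t | ∸-def ((u + v) * s) (u * t) =
      solve 4 (λ u v s t → (u :* (s :- t)) :+ (v :* s) := ((u :+ v) :* s) :- (u :* t)) refl u v s t
    product-rule : ∀ x → (u x * Δ a h x) + (u a * h (x ⊹ a)) ≡ Δ a (λ x → u x * h x) x
    product-rule x =
      trans (identity (u x) (u a) (h (x ⊹ a)) (h x))
        (cong (λ w → (w * h (x ⊹ a)) ∸ (u x * h x)) (sym (additive x a)))

  degreeBelow-1⇒constant : ∀ {h} → DegreeBelow 1 h → ∀ x → h x ≡ h 0A
  degreeBelow-1⇒constant {h} h<1 x = trans (cong h (sym (G.identityˡ x))) (∸≡0⇒≡ (h<1 x 0A))

-- Exponential sums in the group ring.

module Harmonic
  {A : Set} {_⊹_ : Op₂ A} {0A : A} {negA : Op₁ A} (isAG : IsAbelianGroup _≡_ _⊹_ 0A negA)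
  (_≟ᴬ_ : DecidableEquality A) (EA : Enumeration A)
  {F : Set} {_+_ _*_ : Op₂ F} { -_ : Op₁ F} {0# 1# : F} (isCR : IsCommutativeRing _≡_ _+_ _*_ -_ 0# 1#)
  {_∸_ : Op₂ F} (∸-def : ∀ a b → a ∸ b ≡ a + (- b))
  (_≟ᶠ_ : DecidableEquality F) (EF : Enumeration F) (1≢0 : 1# ≢ 0#)
  (multiples : ∀ {a} → a ≢ 0# → ∀ c → ∃ λ m →
      Algebra.Definitions.RawMonoid._×_ (CommutativeRing.+-rawMonoid (RingSolver.ring isCR)) m a ≡ c)
  where

  open RingSolver isCR
  open Differences isAG isCR ∸-def
  private
    module R = CommutativeRing ring
    open Algebra.Definitions.RawMonoid R.+-rawMonoid using () renaming (_×_ to _∙_)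
    module G = IsAbelianGroup isAG
    module EA = Enumeration EA
    module EF = Enumeration EF

  size : ℕ
  size = length EA.elements

  ∑ᴬ : (A → ℤ) → ℤ
  ∑ᴬ = ∑ EA.elements

  δᶠ : F → F → ℤ
  δᶠ = δ _≟ᶠ_

  ∑ᴬ-translate : ∀ c (F : A → ℤ) → ∑ᴬ (λ x → F (x ⊹ c)) ≡ ∑ᴬ F
  ∑ᴬ-translate c = ∑-reindex EA (_⊹ c) (_⊹ negA c)
    (λ x → trans (G.assoc x (negA c) c) (trans (cong (x ⊹_) (G.inverseˡ c)) (G.identityʳ x)))
    (λ x → trans (G.assoc x c (negA c)) (trans (cong (x ⊹_) (G.inverseʳ c)) (G.identityʳ x)))

  ∑ᴬ-translateˡ : ∀ c (F : A → ℤ) → ∑ᴬ (λ x → F (c ⊹ x)) ≡ ∑ᴬ F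
  ∑ᴬ-translateˡ c F = trans (∑-cong EA.elements (λ x → cong F (G.comm c x))) (∑ᴬ-translate c F)

  -- The element Σ_x ω^(h x) of the group ring.
  N : (A → F) → F → ℤ
  N h k = ∑ᴬ (λ x → δᶠ (h x) k)

  N-cong : ∀ {h l} → (∀ x → h x ≡ l x) → ∀ k → N h k ≡ N l k
  N-cong h≗l k = ∑-cong EA.elements (λ x → cong (λ y → δᶠ y k) (h≗l x))

  N-constant : ∀ {h c} → (∀ x → h x ≡ c) → ∀ k → N h k ≡ ℤ.+ size ℤ.* δᶠ c k
  N-constant {c = c} h≡c k = trans (N-cong h≡c k) (∑-const EA.elements (δᶠ c k))

  -- Translating the summation variable leaves the sum unchanged but multiplies it by ω^d. The
  -- coefficients are therefore invariant under the shift by d, whose multiples reach every element.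
  balanced : ∀ {h c d} → d ≢ 0# → (∀ x → h (x ⊹ c) ≡ h x + d) → IsConstant (N h)
  balanced {h} {c} {d} d≢0 step i j with m , m∙d≡i-j ← multiples d≢0 (i R.- j) =
    trans (cong (N h) (trans (solve 2 (λ i j → i := j :+ (i :- j)) refl i j) (cong (j +_) (sym m∙d≡i-j)))) (iterate m j)
    where
    open Algebra.Properties.Group R.+-group using (∙-cancelʳ)
    one-step : ∀ k → N h (k + d) ≡ N h k
    one-step k = trans (sym (∑ᴬ-translate c (λ x → δᶠ (h x) (k + d))))
      (∑-cong EA.elements (λ x → δ-cong _≟ᶠ_
        (λ eq → ∙-cancelʳ d (h x) k (trans (sym (step x)) eq))
        (λ eq → trans (step x) (cong (_+ d) eq))))
    iterate : ∀ m k → N h (k + (m ∙ d)) ≡ N h k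
    iterate zero    k = cong (N h) (R.+-identityʳ k)
    iterate (suc m) k = trans (cong (N h) (sym (R.+-assoc k d (m ∙ d)))) (trans (iterate m (k + d)) (one-step k))

  -- The product of u with its conjugate; the index `- (k ∸ j)` is what `_·ω_` and `conjω` unfold
  -- to.
  norm : (F → ℤ) → F → ℤ
  norm u k = ∑ EF.elements (λ j → u j ℤ.* u (- (k ∸ j)))

  norm-cong : ∀ {u v} → (∀ k → u k ≡ v k) → ∀ k → norm u k ≡ norm v k
  norm-cong u≗v k = ∑-cong EF.elements (λ j → cong₂ ℤ._*_ (u≗v j) (u≗v (- (k ∸ j))))

  -- The product of S(h) with its conjugate is the double sum of ω^(h x - h x′); substitute x = x′ +
  -- a.
  norm-N : ∀ h k → norm (N h) k ≡ ∑ᴬ (λ a → N (Δ a h) k)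
  norm-N h k = begin
    ∑ EF.elements (λ j → N h j ℤ.* N h (- (k ∸ j)))
      ≡⟨ ∑-cong EF.elements (λ j → trans (ℤₚ.*-comm (N h j) (w j)) (*-∑ (w j) EA.elements (λ x → δᶠ (h x) j))) ⟩
    ∑ EF.elements (λ j → ∑ᴬ (λ x → w j ℤ.* δᶠ (h x) j))
      ≡⟨ ∑-swap EF.elements EA.elements (λ j x → w j ℤ.* δᶠ (h x) j) ⟩
    ∑ᴬ (λ x → ∑ EF.elements (λ j → w j ℤ.* δᶠ (h x) j))
      ≡⟨ ∑-cong EA.elements
        (λ x → trans (∑-cong EF.elements (λ j → ℤₚ.*-comm (w j) (δᶠ (h x) j)))
        (∑-δ _≟ᶠ_ EF.unique (EF.complete (h x)) w)) ⟩
    ∑ᴬ (λ x → ∑ᴬ (λ x′ → δᶠ (h x′) (- (k ∸ h x))))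
      ≡⟨ ∑-swap EA.elements EA.elements (λ x x′ → δᶠ (h x′) (- (k ∸ h x))) ⟩
    ∑ᴬ (λ x′ → ∑ᴬ (λ x → δᶠ (h x′) (- (k ∸ h x))))
      ≡⟨ ∑-cong EA.elements (λ x′ → sym (∑ᴬ-translateˡ x′ (λ x → δᶠ (h x′) (- (k ∸ h x))))) ⟩
    ∑ᴬ (λ x′ → ∑ᴬ (λ a → δᶠ (h x′) (- (k ∸ h (x′ ⊹ a)))))
      ≡⟨ ∑-cong EA.elements
        (λ x′ → ∑-cong EA.elements (λ a → δ-cong _≟ᶠ_ (to (h x′) (h (x′ ⊹ a))) (from (h x′) (h (x′ ⊹ a))))) ⟩
    ∑ᴬ (λ x′ → ∑ᴬ (λ a → δᶠ (Δ a h x′) k))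
      ≡⟨ ∑-swap EA.elements EA.elements (λ x′ a → δᶠ (Δ a h x′) k) ⟩
    ∑ᴬ (λ a → N (Δ a h) k) ∎
    where
    open ≡-Reasoning
    w : F → ℤ
    w j = N h (- (k ∸ j))
    to : ∀ s t → s ≡ - (k ∸ t) → t ∸ s ≡ k
    to s t refl rewrite ∸-def k t | ∸-def t (- (k + (- t))) = solve 2 (λ k t → t :- (:- (k :- t)) := k) refl k t
    from : ∀ s t → t ∸ s ≡ k → s ≡ - (k ∸ t)
    from s t refl rewrite ∸-def t s | ∸-def (t + (- s)) t = solve 2 (λ s t → s := :- ((t :- s) :- t)) refl s t

  integer : F → ℤ
  integer k = if does (k ≟ᶠ 0#) then ℤ.+ size else ℤ.+ 0

  integer-δ : ∀ {c k l} → (c ≡ k → l ≡ 0#) → (l ≡ 0# → c ≡ k) → integer l ≡ ℤ.+ size ℤ.* δᶠ c k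
  integer-δ {c} {k} {l} to from with l ≟ᶠ 0#
  ... | yes l≡0 = trans (sym (ℤₚ.*-identityʳ (ℤ.+ size))) (cong (ℤ.+ size ℤ.*_) (sym (δ-yes _≟ᶠ_ (from l≡0))))
  ... | no  l≢0 = trans (sym (ℤₚ.*-zeroʳ (ℤ.+ size))) (cong (ℤ.+ size ℤ.*_) (sym (δ-no _≟ᶠ_ (l≢0 ∘ to))))

  N-0 : ∀ {h} → (∀ x → h x ≡ 0#) → ∀ k → N h k ≡ integer k
  N-0 h≡0 k = trans (N-constant h≡0 k) (sym (integer-δ sym sym))

  Δ-0A : ∀ h x → Δ 0A h x ≡ 0#
  Δ-0A h x = trans (cong (λ y → h y ∸ h x) (G.identityʳ x)) (∸-self (h x))

  -- Bentness and derivatives, for a nondegenerate bilinear form.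

  module WalshSpectrum (B : A → A → F)
    (B-+ˡ : ∀ x x′ y → B (x ⊹ x′) y ≡ B x y + B x′ y)
    (B-+ʳ : ∀ x y y′ → B x (y ⊹ y′) ≡ B x y + B x y′)
    (B-nondegenerate : ∀ x → x ≢ 0A → ∃ λ y → B x y ≢ 0#)
    (f : A → F) where

    φ : A → A → F
    φ y x = f x ∸ B x y

    Δ-φ : ∀ a y x → Δ a (φ y) x ≡ Δ a f x ∸ B a y
    Δ-φ a y x = trans (cong (λ b → (f (x ⊹ a) ∸ b) ∸ (f x ∸ B x y)) (B-+ˡ x a y)) (identity _ _ _ _)
      where
      identity : ∀ s t b c → (s ∸ (b + c)) ∸ (t ∸ b) ≡ (s ∸ t) ∸ c
      identity s t b c rewrite ∸-def (s ∸ (b + c)) (t ∸ b) | ∸-def s (b + c) | ∸-def t b | ∸-def (s ∸ t) c | ∸-def s t =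
        solve 4 (λ s t b c → (s :- (b :+ c)) :- (t :- b) := (s :- t) :- c) refl s t b c

    Bent′ : Set
    Bent′ = ∀ y → ∃ λ c → ∀ k → norm (N (φ y)) k ℤ.- integer k ≡ c

    HasConstantDerivative : (A → F) → Set
    HasConstantDerivative h = ∃ λ b → ∃ λ c → c ≢ 0# × (∀ x → Δ b h x ≡ c)

    constantDerivative⇒balanced : ∀ {h} → HasConstantDerivative h → IsConstant (N h)
    constantDerivative⇒balanced (b , c , c≢0 , Δ≡c) = balanced c≢0 (λ x → ∸≡⇒≡+ (Δ≡c x))

    -- In `norm-N` for `φ y`, each a ≠ 0 gives a balanced term, because Δ_a (φ y) differs from Δ_a f
    -- by the constant B a y. The term a = 0 is the integer `size`.
    cubic-like⇒bent : (∀ a → a ≢ 0A → HasConstantDerivative (Δ a f)) → Bent′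
    cubic-like⇒bent cubic-like y = difference 0# , λ k → constant k 0#
      where
      difference : F → ℤ
      difference k = norm (N (φ y)) k ℤ.- integer k
      summand-constant : ∀ a → a ≢ 0A → IsConstant (N (Δ a (φ y)))
      summand-constant a a≢0 with b , c , c≢0 , Δ≡c ← cubic-like a a≢0 = balanced {c = b} c≢0 step
        where
        step : ∀ x → Δ a (φ y) (x ⊹ b) ≡ Δ a (φ y) x + c
        step x = begin
          Δ a (φ y) (x ⊹ b)             ≡⟨ Δ-φ a y (x ⊹ b) ⟩
          Δ a f (x ⊹ b) ∸ B a y         ≡⟨ cong (_∸ B a y) (∸≡⇒≡+ (Δ≡c x)) ⟩
          (Δ a f x + c) ∸ B a y         ≡⟨ identity (Δ a f x) c (B a y) ⟩
          (Δ a f x ∸ B a y) + c         ≡⟨ cong (_+ c) (Δ-φ a y x) ⟨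
          Δ a (φ y) x + c               ∎
          where
          open ≡-Reasoning
          identity : ∀ s c b → (s + c) ∸ b ≡ (s ∸ b) + c
          identity s c b rewrite ∸-def (s + c) b | ∸-def s b =
            solve 3 (λ s c b → (s :+ c) :- b := (s :- b) :+ c) refl s c b
      split : ∀ k → difference k ≡ ∑ᴬ (λ a → N (Δ a (φ y)) k) ℤ.- N (Δ 0A (φ y)) k
      split k = cong₂ ℤ._-_ (norm-N (φ y) k) (sym (N-0 (Δ-0A (φ y)) k))
      constant : IsConstant difference
      constant j k = trans (split j) (trans (∑-isolate _≟ᴬ_ EA 0A summand-constant j k) (sym (split k)))

    -- Fourier inversion of |W|² = p^n: its a-th coefficient is p^n Σ_x ω^(D_a f x).
    bent⇒derivative-balanced : Bent′ → ∀ a → a ≢ 0A → IsConstant (N (Δ a f))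
    bent⇒derivative-balanced bent a a≢0 j k = ℤₚ.*-cancelˡ-≡ (ℤ.+ size) _ _ {{size-nonZero}} (begin
      ℤ.+ size ℤ.* N (Δ a f) j    ≡⟨ diagonal j ⟨
      -- `Z` and `Z − G′ a` are both constant, hence so is `G′ a`.
      G′ a j                      ≡⟨ recover (Z j) (G′ a j) ⟩
      Z j ℤ.- (Z j ℤ.- G′ a j)    ≡⟨ cong₂ ℤ._-_ (Z-constant j k) rest ⟩
      Z k ℤ.- (Z k ℤ.- G′ a k)    ≡⟨ recover (Z k) (G′ a k) ⟨
      G′ a k                      ≡⟨ diagonal k ⟩
      ℤ.+ size ℤ.* N (Δ a f) k    ∎)
      where
      open ≡-Reasoning
      open Algebra.Properties.Group R.+-group using (∙-cancelʳ)
      size-nonZero : ℤ.NonZero (ℤ.+ size)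
      size-nonZero = nonEmpty (EA.complete 0A)
        where
        nonEmpty : ∀ {x} {xs : List A} → x ∈ xs → ℤ.NonZero (ℤ.+ length xs)
        nonEmpty {xs = _ ∷ _} _ = _
      -- The sum of ω^(B a y) |W(y)|² over y; multiplying by ω^(B a y) shifts the coefficient index.
      -- `G′ b` is the part contributed by Δ_b when |W(y)|² is expanded by `norm-N`.
      Z : F → ℤ
      Z k = ∑ᴬ (λ y → norm (N (φ y)) (k ∸ B a y))
      G′ : A → F → ℤ
      G′ b k = ∑ᴬ (λ y → N (Δ b (φ y)) (k ∸ B a y))
      recover : ∀ z g → g ≡ z ℤ.- (z ℤ.- g)
      recover = ℤ-Solver.solve-∀
      ∸-+ : ∀ s t → (s ∸ t) + t ≡ s
      ∸-+ s t rewrite ∸-def s t = solve 2 (λ s t → (s :- t) :+ t := s) refl s t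
      +-∸ : ∀ s t → (s + t) ∸ t ≡ s
      +-∸ s t rewrite ∸-def (s + t) t = solve 2 (λ s t → (s :+ t) :- t := s) refl s t
      -- Bentness replaces |W(y)|² by `size` up to a constant vector, which the shift does not
      -- affect; what is left is a nontrivial character sum.
      Z-constant : IsConstant Z
      Z-constant j k = trans (value j) (trans (cong (λ z → ℤ.+ size ℤ.* z ℤ.+ ∑ᴬ c) (character j k)) (sym (value k)))
        where
        c : A → ℤ
        c y = let c , _ = bent y in c
        norm-value : ∀ y k → norm (N (φ y)) k ≡ integer k ℤ.+ c y
        norm-value y k =
          let _ , eq = bent y
          in  trans (add (norm (N (φ y)) k) (integer k)) (cong (λ z → integer k ℤ.+ z) (eq k))
          where
          add : ∀ s t → s ≡ t ℤ.+ (s ℤ.- t)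
          add = ℤ-Solver.solve-∀
        value : ∀ k → Z k ≡ ℤ.+ size ℤ.* N (B a) k ℤ.+ ∑ᴬ c
        value k = begin
          Z k
            ≡⟨ ∑-cong EA.elements (λ y → norm-value y (k ∸ B a y)) ⟩
          ∑ᴬ (λ y → integer (k ∸ B a y) ℤ.+ c y)                          ≡⟨ ∑-+ EA.elements _ c ⟩
          ∑ᴬ (λ y → integer (k ∸ B a y)) ℤ.+ ∑ᴬ c
            ≡⟨ cong (λ z → z ℤ.+ ∑ᴬ c)
              (∑-cong EA.elements (λ y → integer-δ {B a y} {k} (λ eq → trans (cong (k ∸_) eq) (∸-self k))
              (λ eq → sym (∸≡0⇒≡ eq)))) ⟩
          ∑ᴬ (λ y → ℤ.+ size ℤ.* δᶠ (B a y) k) ℤ.+ ∑ᴬ c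
            ≡⟨ cong (λ z → z ℤ.+ ∑ᴬ c) (*-∑ (ℤ.+ size) EA.elements (λ y → δᶠ (B a y) k)) ⟨
          ℤ.+ size ℤ.* N (B a) k ℤ.+ ∑ᴬ c                                 ∎
        character : IsConstant (N (B a))
        character = let y₀ , B≢0 = B-nondegenerate a a≢0 in balanced B≢0 (λ y → B-+ʳ a y y₀)
      -- Summed over y first, each x leaves a character sum of B (a - b), nontrivial because the
      -- form is nondegenerate.
      off-diagonal : ∀ b → b ≢ a → IsConstant (G′ b)
      off-diagonal b b≢a j k = trans (exchange j) (trans (∑-constant EA.elements inner j k) (sym (exchange k)))
        where
        h : A → A → F
        h x y = (Δ b f x ∸ B b y) + B a y
        exchange : ∀ k → G′ b k ≡ ∑ᴬ (λ x → N (h x) k)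
        exchange k = trans (∑-cong EA.elements (λ y → ∑-cong EA.elements (λ x → δ-cong _≟ᶠ_
            (λ eq → trans (cong (_+ B a y) (trans (sym (Δ-φ b y x)) eq)) (∸-+ k (B a y)))
            (λ eq → trans (Δ-φ b y x) (trans (sym (+-∸ _ (B a y))) (cong (_∸ B a y) eq))))))
          (∑-swap EA.elements EA.elements (λ y x → δᶠ (h x y) k))
        inner : ∀ x → IsConstant (N (h x))
        inner x = let y₀ , B≢0 = B-nondegenerate (a ⊹ negA b) a-b≢0 in balanced B≢0 (step y₀)
          where
          a-b≢0 : a ⊹ negA b ≢ 0A
          a-b≢0 a-b≡0 = b≢a (sym (trans (sym (G.identityʳ a)) (trans (cong (a ⊹_) (sym (G.inverseˡ b)))
            (trans (sym (G.assoc a (negA b) b)) (trans (cong (_⊹ b) a-b≡0) (G.identityˡ b))))))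
          B-split : ∀ y → B a y ≡ B (a ⊹ negA b) y + B b y
          B-split y =
            trans (cong (λ z → B z y)
              (sym (trans (G.assoc a (negA b) b) (trans (cong (a ⊹_) (G.inverseˡ b)) (G.identityʳ a)))))
            (B-+ˡ (a ⊹ negA b) b y)
          step : ∀ y₀ y → h x (y ⊹ y₀) ≡ h x y + B (a ⊹ negA b) y₀
          step y₀ y =
            trans (cong₂ (λ s t → (Δ b f x ∸ s) + t) (B-+ʳ b y y₀)
              (trans (B-+ʳ a y y₀) (cong (B a y +_) (B-split y₀))))
            (identity (Δ b f x) (B b y) (B b y₀) (B a y) (B (a ⊹ negA b) y₀))
            where
            identity : ∀ s t u v w → (s ∸ (t + u)) + (v + (w + u)) ≡ ((s ∸ t) + v) + w
            identity s t u v w rewrite ∸-def s (t + u) | ∸-def s t =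
              solve 5 (λ s t u v w → (s :- (t :+ u)) :+ (v :+ (w :+ u)) := ((s :- t) :+ v) :+ w) refl s t u v w
      rest : Z j ℤ.- G′ a j ≡ Z k ℤ.- G′ a k
      rest =
        trans (cong (ℤ._- G′ a j) (expand j))
          (trans (∑-isolate _≟ᴬ_ EA a off-diagonal j k) (cong (ℤ._- G′ a k) (sym (expand k))))
        where
        expand : ∀ k → Z k ≡ ∑ᴬ (λ b → G′ b k)
        expand k =
          trans (∑-cong EA.elements (λ y → norm-N (φ y) (k ∸ B a y)))
            (∑-swap EA.elements EA.elements (λ y b → N (Δ b (φ y)) (k ∸ B a y)))
      -- At b = a the twist cancels the linear term, so y drops out and its sum contributes the
      -- factor `size`.
      diagonal : ∀ k → G′ a k ≡ ℤ.+ size ℤ.* N (Δ a f) k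
      diagonal k = trans (∑-cong EA.elements (λ y → ∑-cong EA.elements (λ x → δ-cong _≟ᶠ_
            (λ eq → trans (sym (∸-+ _ (B a y))) (trans (cong (_+ B a y) (trans (sym (Δ-φ a y x)) eq)) (∸-+ k (B a y))))
            (λ eq → trans (Δ-φ a y x) (cong (_∸ B a y) eq)))))
        (∑-const EA.elements (N (Δ a f) k))

    -- |Σ_x ω^(q x)|² = Σ_b Σ_x ω^(D_b q x), where D_b q is affine: without b as
    -- claimed, each inner sum vanishes or equals p^n, and that for b = 0 is p^n.
    balanced-quadratic : ∀ {q} → DegreeBelow 3 q → IsConstant (N q) → HasConstantDerivative q
    balanced-quadratic {q} q<3 N-q with Any.any? good? EA.elements
      where
      -- Comparing with the value at `0A` makes constancy decidable, so b can be found by search.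
      good? : ∀ b → Dec (Δ b q 0A ≢ 0# × All (λ x → Δ b q x ≡ Δ b q 0A) EA.elements)
      good? b = ¬? (Δ b q 0A ≟ᶠ 0#) ×-dec All.all? (λ x → Δ b q x ≟ᶠ Δ b q 0A) EA.elements
    ... | yes found =
      let b , Δ≢0 , constant = Any.satisfied found
      in  b , Δ b q 0A , Δ≢0 , λ x → All.lookup constant (EA.complete x)
    -- The coefficients at 1 and 0 are compared instead of complex values. Their totals agree
    -- because the norm of a constant vector is constant, yet no b has the larger coefficient at 1,
    -- and b = 0 has a strictly larger one at 0.
    ... | no  none  = contradiction norm-equal (ℤₚ.<⇒≢ (∑-< (EA.complete 0A) decrease strict))
      where
      norm-equal : ∑ᴬ (λ b → N (Δ b q) 1#) ≡ ∑ᴬ (λ b → N (Δ b q) 0#)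
      norm-equal = trans (sym (norm-N q 1#)) (trans
        (∑-cong EF.elements (λ j → cong (N q j ℤ.*_) (N-q (- (1# ∸ j)) (- (0# ∸ j)))))
        (norm-N q 0#))
      integer-1 : integer 1# ≡ ℤ.0ℤ
      integer-1 with 1# ≟ᶠ 0#
      ... | yes 1≡0 = contradiction 1≡0 1≢0
      ... | no  _   = refl
      integer-0 : integer 0# ≡ ℤ.+ size
      integer-0 with 0# ≟ᶠ 0#
      ... | yes _   = refl
      ... | no  0≢0 = contradiction refl 0≢0
      decrease-0 : ∀ {h} → (∀ x → h x ≡ 0#) → N h 1# ℤ.< N h 0#
      decrease-0 h≡0 =
        subst₂ ℤ._<_ (sym (trans (N-0 h≡0 1#) integer-1)) (sym (trans (N-0 h≡0 0#) integer-0))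
          (nonEmpty (EA.complete 0A))
        where
        nonEmpty : ∀ {x} {xs : List A} → x ∈ xs → ℤ.0ℤ ℤ.< ℤ.+ length xs
        nonEmpty {xs = _ ∷ _} _ = ℤ.+<+ (s≤s z≤n)
      strict : N (Δ 0A q) 1# ℤ.< N (Δ 0A q) 0#
      strict = decrease-0 (Δ-0A q)
      decrease : ∀ b → N (Δ b q) 1# ℤ.≤ N (Δ b q) 0#
      decrease b with All.all? (λ x → Δ b q x ≟ᶠ Δ b q 0A) EA.elements
      ... | yes constant with Δ b q 0A ≟ᶠ 0#
      ...   | yes Δ≡0 = ℤₚ.<⇒≤ (decrease-0 (λ x → trans (All.lookup constant (EA.complete x)) Δ≡0))
      ...   | no  Δ≢0 = contradiction (lose (EA.complete b) (Δ≢0 , constant)) none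
      -- A nonconstant affine function has a nonzero constant difference, so it is balanced and the
      -- two coefficients agree.
      decrease b | no nonconstant =
        let x , Δ≢ = Any.satisfied (Allₚ.¬All⇒Any¬ (λ x → Δ b q x ≟ᶠ Δ b q 0A) EA.elements nonconstant) in
        ℤₚ.≤-reflexive (constantDerivative⇒balanced {Δ b q}
          (x , Δ x (Δ b q) 0A , (λ eq → Δ≢ (trans (cong (Δ b q) (sym (G.identityˡ x))) (∸≡0⇒≡ eq))) , degreeBelow-1⇒constant (q<3 b x))
          1# 0#)

    -- One difference lowers f to degree at most two, where `balanced-quadratic` applies.
    bent⇒cubic-like : DegreeBelow 4 f → Bent′ → ∀ a → a ≢ 0A → HasConstantDerivative (Δ a f)
    bent⇒cubic-like f<4 bent a a≢0 = balanced-quadratic (f<4 a) (bent⇒derivative-balanced bent a a≢0)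

-- From the algebraic normal form to vanishing differences.

module PolynomialDegree (p : ℕ) {{_ : NonZero p}} (n : ℕ) where

  open PrimeField p
  open VectorSpace p
  open Differences (⊹-isAbelianGroup {n}) isCommutativeRing -ᶠ-def
  private module F = CommutativeRing ring

  degreeBelow-^ : ∀ e k (u h : V p n → Fp p) → (∀ x a → u (x ⊹ a) ≡ u x +ᶠ u a) → DegreeBelow k h →
                  DegreeBelow (e ℕ.+ k) (λ x → _^ₚ_ p (u x) e *ᶠ h x)
  degreeBelow-^ zero    k u h additive h<k = degreeBelow-cong k (λ x → sym (F.*-identityˡ (h x))) h<k
  degreeBelow-^ (suc e) k u h additive h<k =
    degreeBelow-cong (suc (e ℕ.+ k)) (λ x → sym (F.*-assoc (u x) (_^ₚ_ p (u x) e) (h x)))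
    (degreeBelow-*ˡ (e ℕ.+ k) u (λ x → _^ₚ_ p (u x) e *ᶠ h x) additive (degreeBelow-^ e k u h additive h<k))

  private
    head-⊹ : ∀ {m} (u v : V p (suc m)) → V.head (u ⊹ v) ≡ V.head u +ᶠ V.head v
    head-⊹ (_ ∷ _) (_ ∷ _) = refl

    tail-⊹ : ∀ {m} (u v : V p (suc m)) → V.tail (u ⊹ v) ≡ V.tail u ⊹ V.tail v
    tail-⊹ (_ ∷ _) (_ ∷ _) = refl

    evalMono-[] : ∀ v → 1ᶠ ≡ evalMono p [] v
    evalMono-[] [] = refl

    evalMono-∷ : ∀ {m} e (es : Vec (Fin p) m) v →
        _^ₚ_ p (V.head v) (toℕ e) *ᶠ evalMono p es (V.tail v) ≡ evalMono p (e ∷ es) v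
    evalMono-∷ e es (_ ∷ _) = refl

  -- The additive map φ lets the induction pass to the tail of the coordinates while differences are
  -- still taken in the full space; each coordinate is then an additive function, raised to its
  -- exponent by `degreeBelow-^`.
  degreeBelow-monomial : ∀ {m} (e : Vec (Fin p) m) (φ : V p n → V p m) → (∀ x a → φ (x ⊹ a) ≡ φ x ⊹ φ a) →
                         DegreeBelow (suc (monoDeg p e)) (λ x → evalMono p e (φ x))
  degreeBelow-monomial []       φ additive =
    degreeBelow-cong 1 {λ _ → 1ᶠ} (λ x → evalMono-[] (φ x)) (λ a x → ∸-self 1ᶠ)
  degreeBelow-monomial (e ∷ es) φ additive =
    subst (λ k → DegreeBelow k (λ x → evalMono p (e ∷ es) (φ x))) (ℕₚ.+-suc (toℕ e) (monoDeg p es))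
    (degreeBelow-cong (toℕ e ℕ.+ suc (monoDeg p es)) (λ x → evalMono-∷ e es (φ x))
      (degreeBelow-^ (toℕ e) (suc (monoDeg p es)) (λ x → V.head (φ x)) (λ x → evalMono p es (V.tail (φ x)))
        (λ x a → trans (cong V.head (additive x a)) (head-⊹ (φ x) (φ a)))
        (degreeBelow-monomial es (λ x → V.tail (φ x)) (λ x a → trans (cong V.tail (additive x a)) (tail-⊹ (φ x) (φ a))))))

  degreeBelow-polynomial : ∀ {d} (P : List (Term p n)) → All (λ t → monoDeg p (proj₂ t) ≤ d) P →
      DegreeBelow (suc d) (evalPoly p P)
  degreeBelow-polynomial {d} []            []            = degreeBelow-0 (suc d)
  degreeBelow-polynomial {d} ((c , e) ∷ P) (e≤d ∷ P≤d) =
    degreeBelow-+ (suc d) (λ x → c *ᶠ evalMono p e x) (evalPoly p P)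
    (degreeBelow-scale (suc d) c (evalMono p e) (degreeBelow-≤ (evalMono p e) (s≤s e≤d) (degreeBelow-monomial e (λ x → x) (λ _ _ → refl))))
    (degreeBelow-polynomial P P≤d)

  DegLe⇒degreeBelow : ∀ {d f} → DegLe p f d → DegreeBelow (suc d) f
  DegLe⇒degreeBelow {d} (P , P≤d , eval≡f) = degreeBelow-cong (suc d) eval≡f (degreeBelow-polynomial P P≤d)

-- Specialisation to the trace form and the Walsh transform.

module CubicBent (p : ℕ) {{_ : NonZero p}} (pp : Prime p) {m : ℕ}
  (g : V p (suc m)) (isField : IsField p g) (f : V p (suc m) → Fp p) where

  private n = suc m
  open PrimeField p
  open VectorSpace p
  open TracePairing p pp g isField
  open Differences (⊹-isAbelianGroup {n}) isCommutativeRing -ᶠ-def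
  open PolynomialDegree p n

  private
    enumerateFp : Enumeration (Fp p)
    enumerateFp = record { elements = allFin p ; unique = Uniqueₚ.allFin⁺ p ; complete = ∈-allFin }

  open Harmonic (⊹-isAbelianGroup {n}) (_≟ⱽ_ p) (enumerateV p n) isCommutativeRing -ᶠ-def Finₚ._≟_ enumerateFp (1ᶠ≢0ᶠ pp) (multiples pp)
  open WalshSpectrum (λ x y → Tr p g (fmul p g x y)) pairing-+ˡ pairing-+ʳ pairing-nondegenerate f

  Walsh≡N : ∀ y k → Walsh p g f y k ≡ N (φ y) k
  Walsh≡N y k = length-filter (λ x → φ y x Finₚ.≟ k) (allV p n)

  private
    difference≡ : ∀ y k → norm (Walsh p g f y) k ℤ.- intω p (p ℕ.^ n) k ≡ norm (N (φ y)) k ℤ.- integer k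
    difference≡ y k = cong₂ ℤ._-_ (norm-cong (Walsh≡N y) k)
      (cong (λ q → if does (k Finₚ.≟ 0ᶠ) then ℤ.+ q else ℤ.+ 0) (sym (length-allV p n)))

  Bent⇒Bent′ : Bent p g f → Bent′
  Bent⇒Bent′ bent y = map₂ (λ eq k → trans (sym (difference≡ y k)) (eq k)) (bent y)

  Bent′⇒Bent : Bent′ → Bent p g f
  Bent′⇒Bent bent y = map₂ (λ eq k → trans (difference≡ y k) (eq k)) (bent y)

  bent⇔cubicLikeBent : Cubic p f → Bent p g f ⇔ CubicLikeBent p f
  bent⇔cubicLikeBent (f≤3 , _) = mk⇔
    (λ bent a a≢0 → map₂ (map₂ (map₂ λ eq x → trans (sym (Δ-swap a _ f x)) (eq x)))
      (bent⇒cubic-like (DegLe⇒degreeBelow f≤3) (Bent⇒Bent′ bent) a a≢0))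
    (λ cubicLike → Bent′⇒Bent (cubic-like⇒bent (λ a a≢0 →
      map₂ (map₂ (map₂ λ eq x → trans (Δ-swap a _ f x) (eq x))) (cubicLike a a≢0))))

theorem3 : (p : ℕ) {{_ : NonZero p}} → Prime p → (n : ℕ) → 1 ≤ n →
    (g : Vec (Fin p) n) → IsField p g →
    (f : Vec (Fin p) n → Fin p) → Cubic p f →
    (Bent p g f ⇔ CubicLikeBent p f)
theorem3 p pp (suc m) _ g isField f cubic = CubicBent.bent⇔cubicLikeBent p pp g isField f cubic
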